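{- For every $n\ge 1$, $|\mathrm{Sort}_n(132,321)|$ equals the $n$-th term of OEIS sequence A102407, i.e. the number of Dyck paths of semilength $n$ that do not contain $dudu$ as a factor (four consecutive steps down, up, down, up).
   Context: A permutation $x$ contains a pattern $p$ if it has a subsequence order-isomorphic to $p$; otherwise it avoids $p$. For a set $T$ of patterns, the map $s_T$ is defined as follows: the entries of the input permutation $x=x_1\cdots x_n$ are read from left to right, with an initially empty stack. At each step, if the input is nonempty and pushing the next input entry onto the stack produces a stack whose contents, read from top to bottom, avoid every pattern in $T$, that entry is pushed; otherwise the top entry of the stack is popped and appended to the output. When the input is exhausted, the remaining stack entries are popped one at a time to the output. $s_T(x)$ is the output word. Write $s_{\sigma,\tau}=s_{\{\sigma,\tau\}}$ and $s=s_{\{21\}}$ (West's stack-sorting map, whose stack is increasing from top to bottom). $\mathrm{Sort}_n(\sigma,\tau)$ is the set of $x\in S_n$ such that $s(s_{\sigma,\tau}(x))=12\cdots n$. A Dyck path of semilength $n$ is a lattice path from $(0,0)$ to $(2n,0)$ with steps $u=(1,1)$ and $d=(1,-1)$ never going below the $x$-axis. -}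

module Defs where

open import Data.Bool.Base using (if_then_else_)
open import Data.Fin.Base using (Fin; cast)
open import Data.Fin.Properties using (all?)
open import Data.Integer.Base as ℤ using (ℤ; 0ℤ; 1ℤ; -1ℤ)
open import Data.List.Base using (List; []; _∷_; _++_; length; lookup; map; upTo)
open import Data.List.Membership.Propositional using (_∈_)
open import Data.List.Relation.Binary.Infix.Heterogeneous using (Infix)
open import Data.List.Relation.Binary.Permutation.Propositional using (_↭_)
open import Data.List.Relation.Binary.Sublist.Propositional using (_⊆_; []; _∷_; _∷ʳ_)
open import Data.List.Relation.Unary.All as All using ()
open import Data.List.Relation.Unary.Unique.Propositional using (Unique)
open import Data.Nat.Base using (ℕ; _*_; _<_)
open import Data.Nat.Properties using (_≟_; _<?_)
open import Data.Product.Base using (Σ; ∃; _×_; _,_)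
open import Data.Sum.Base using (inj₁; inj₂; [_,_]′)
open import Function.Bundles using (_⇔_; mk⇔; Equivalence)
open import Level using (0ℓ)
open import Relation.Binary.PropositionalEquality.Core using (_≡_; refl)
open import Relation.Nullary.Decidable using (Dec; does; yes; no; map′; _×-dec_; _→-dec_; _⊎-dec_; ¬?)
open import Relation.Nullary.Negation using (¬_)
open import Relation.Unary using (Pred; Decidable)

record HasCardinality {A : Set} (P : Pred A 0ℓ) (k : ℕ) : Set where
  field
    elements    : List A
    unique      : Unique elements
    ∈-elements⇔ : ∀ a → a ∈ elements ⇔ P a
    size        : length elements ≡ k

Word : Set
Word = List ℕ

identity : ℕ → Word
identity n = map ℕ.suc (upTo n)

IsPermutation : ℕ → Pred Word 0ℓ
IsPermutation n x = x ↭ identity n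

OrderIsomorphic : Word → Word → Set
OrderIsomorphic v w = Σ (length v ≡ length w) λ eq → ∀ (i j : Fin (length v)) →
  lookup v i < lookup v j ⇔ lookup w (cast eq i) < lookup w (cast eq j)

Contains : Word → Word → Set
Contains x p = ∃ λ y → y ⊆ x × OrderIsomorphic y p

Avoids : Word → Word → Set
Avoids x p = ¬ Contains x p

orderIsomorphic? : ∀ v w → Dec (OrderIsomorphic v w)
orderIsomorphic? v w with length v ≟ length w
... | no  neq = no λ { (eq , _) → neq eq }
... | yes eq  = map′ (eq ,_) (λ { (_ , iso) → iso })
  (all? λ i → all? λ j →
    ⇔-dec (lookup v i <? lookup v j) (lookup w (cast eq i) <? lookup w (cast eq j)))
  where
  ⇔-dec : {A B : Set} → Dec A → Dec B → Dec (A ⇔ B)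
  ⇔-dec a? b? = map′ (λ { (f , g) → mk⇔ f g })
    (λ e → Equivalence.to e , Equivalence.from e)
    ((a? →-dec b?) ×-dec (b? →-dec a?))

anySublist? : {P : Pred Word 0ℓ} → Decidable P → ∀ x → Dec (∃ λ y → y ⊆ x × P y)
anySublist? P? []      = map′ (λ p → [] , [] , p) (λ { (_ , [] , p) → p }) (P? [])
anySublist? P? (a ∷ x) = map′
  [ (λ { (y , y⊆x , p) → a ∷ y , refl ∷ y⊆x , p })
  , (λ { (y , y⊆x , p) → y , a ∷ʳ y⊆x , p }) ]′
  (λ { (_ , refl ∷ y⊆x , p) → inj₁ (_ , y⊆x , p)
     ; (_ , _ ∷ʳ y⊆x   , p) → inj₂ (_ , y⊆x , p) })
  (anySublist? (λ y → P? (a ∷ y)) x ⊎-dec anySublist? P? x)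

avoids? : ∀ x p → Dec (Avoids x p)
avoids? x p = ¬? (anySublist? (λ y → orderIsomorphic? y p) x)

-- process T stack input is the output still to be produced by the machine; the
-- head of stack is its top, so a stack list reads from top to bottom.
-- An entry is always pushed onto an empty stack: this is forced as long as the
-- patterns have length at least 2, the only ones for which the machine makes
-- sense.
process : List Word → Word → Word → Word
process T stack       []          = stack
process T []          (a ∷ input) = process T (a ∷ []) input
process T (t ∷ stack) (a ∷ input) =
  if does (All.all? (avoids? (a ∷ t ∷ stack)) T)
  then process T (a ∷ t ∷ stack) input
  else t ∷ process T stack (a ∷ input)

stackSort : List Word → Word → Word
stackSort T = process T []

west : Word → Word
west = stackSort ((2 ∷ 1 ∷ []) ∷ [])

Sort : ℕ → Word → Word → Pred Word 0ℓ
Sort n σ τ x = IsPermutation n x × west (stackSort (σ ∷ τ ∷ []) x) ≡ identity n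

data Step : Set where
  u d : Step

rise : Step → ℤ
rise u = 1ℤ
rise d = -1ℤ

height : List Step → ℤ
height []      = 0ℤ
height (s ∷ w) = rise s ℤ.+ height w

record IsDyckPath (n : ℕ) (w : List Step) : Set where
  field
    steps       : length w ≡ 2 * n
    endsOnAxis  : height w ≡ 0ℤ
    nonnegative : ∀ v v′ → v ++ v′ ≡ w → 0ℤ ℤ.≤ height v

HasFactor : List Step → List Step → Set
HasFactor w f = Infix _≡_ f w

DyckAvoidingFactor : ℕ → List Step → Pred (List Step) 0ℓ
DyckAvoidingFactor n f w = IsDyckPath n w × ¬ HasFactor w f

{-# OPTIONS --safe #-}
module Submission where

-- Let x = m ∷ xs, and call an entry small or large according to whether it is below or
-- above m.  Since m stays at the bottom of the stack, s_{132,321}(x) avoids 231 iff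
--   * the word w of small entries is itself sortable,
--   * the large entries decrease from left to right, no two of them being adjacent, and
--   * each of them lies in a good gap of w: when the machine on w reaches that gap, its
--     stack increases from top to bottom and everything output so far is below the rest.
-- The good gaps of x are its front and those good gaps of w (moved behind m) that are not
-- to the right of the leftmost large entry.  So a sortable permutation is built from the
-- empty word, which has one good gap, by repeatedly choosing a set S of the g good gaps;
-- the next number of good gaps is g + 1 if S is empty, and 1 + min S otherwise.
--
-- Dyck paths avoiding dudu obey the same rule, with g as the height.  Cut a path, after
-- its first step, into u (a stage with S empty, followed by another one) and, visiting
-- the gaps from right to left, d (the gap is not in S), dud (the gap is in S) and duu (the
-- gap is the last one in S, and another stage follows).

open import Defs
open import Data.Bool.Base using (if_then_else_)
open import Data.Empty using (⊥; ⊥-elim)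
open import Data.Fin.Base using (zero; suc)
open import Data.Integer.Base as ℤ using (ℤ; 0ℤ; 1ℤ; -1ℤ)
import Data.Integer.Properties as ℤ
open import Data.List.Base using (List; []; _∷_; _++_; length; map; filter; upTo; InitLast; initLast; _∷ʳ′_)
open import Data.List.Membership.Propositional using (_∈_; _∉_)
open import Data.List.Membership.Propositional.Properties
  using (∈-++⁺ˡ; ∈-++⁺ʳ; ∈-++⁻; ∈-∃++; ∈-map⁺; ∈-map⁻; ∈-upTo⁺; ∈-upTo⁻; ∈-filter⁻)
open import Data.List.Properties using
  (++-assoc; ++-identityʳ; ++-conicalˡ; ++-conicalʳ; filter-accept; filter-reject; filter-++; filter-all;
   map-++; upTo-∷ʳ; ∷-injective; ∷-injectiveʳ; ∷ʳ-injective; length-filter; length-map; length-upTo)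
open import Data.List.Relation.Binary.Infix.Heterogeneous using (here; there)
open import Data.List.Relation.Binary.Permutation.Propositional
  using (_↭_; ↭-refl; ↭-sym; ↭-trans; ↭-prep; ↭-reflexive; ↭⇒↭ₛ)
open import Data.List.Relation.Binary.Permutation.Propositional.Properties
  using (∈-resp-↭; All-resp-↭; shift; ++-comm; ↭-length; filter-↭)
open import Data.List.Relation.Binary.Permutation.Setoid.Properties using (Unique-resp-↭)
open import Data.List.Relation.Binary.Pointwise using (Pointwise-≡⇒≡)
open import Data.List.Relation.Binary.Prefix.Heterogeneous using (Prefix; []; _∷_)
open import Data.List.Relation.Binary.Sublist.Propositional
  using (_⊆_; []; _∷_; _∷ʳ_; ⊆-refl; ⊆-reflexive; ⊆-trans; from∈; to∈; minimum)
open import Data.List.Relation.Binary.Sublist.Propositional.Properties using (∷ˡ⁻; ++⁺; ++⁺ˡ; ++⁺ʳ)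
open import Data.List.Relation.Unary.All as All using (All; []; _∷_)
import Data.List.Relation.Unary.All.Properties as All
open import Data.List.Relation.Unary.AllPairs as AllPairs using (AllPairs; []; _∷_)
import Data.List.Relation.Unary.AllPairs.Properties as AllPairs
open import Data.List.Relation.Unary.Any as Any using (Any; here; there; any?)
import Data.List.Relation.Unary.Any.Properties as Any
open import Data.List.Relation.Unary.Sorted.TotalOrder.Properties using (AllPairs⇒Sorted; ↗↭↗⇒≋)
open import Data.List.Relation.Unary.Unique.Propositional using (Unique)
import Data.List.Relation.Unary.Unique.Propositional.Properties as Unique
open import Data.Nat.Base using (ℕ; zero; suc; _+_; _*_; _≤_; _<_; _≥_; z≤n; s≤s)
open import Data.Nat.Properties
open import Data.Nat.Tactic.RingSolver using (solve-∀)
open import Data.Product.Base using (∃; ∃₂; _×_; _,_; proj₁; proj₂)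
open import Data.Sum.Base using (_⊎_; inj₁; inj₂; [_,_]′)
open import Data.Unit.Base using (⊤; tt)
open import Data.Vec.Base using (Vec; []; _∷_) renaming (_∷ʳ_ to infixl 5 _▷_)
open import Data.Vec.Relation.Unary.All as VAll using ([]; _∷_)
open import Function.Base using (_∘_; id)
open import Function.Bundles using (_⇔_; mk⇔; Equivalence)
open import Relation.Binary.Definitions using (tri<; tri≈; tri>)
open import Relation.Binary.PropositionalEquality
open import Relation.Nullary.Decidable using (Dec; does; yes; no; map′; dec-true; dec-false)
open import Relation.Nullary.Negation using (¬_; contradiction)

private
  variable
    g m n N : ℕ

-- Codes of dudu-avoiding Dyck paths

mutual
  data Rise (g : ℕ) : Set where
    up   : Rise (suc g) → Rise g
    turn : Fall g → Rise g

  data Fall : ℕ → Set where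
    stop  : Fall 0
    fall  : Fall g → Fall (suc g)
    bump  : Fall g → Fall (suc g)
    climb : Rise (suc (suc g)) → Fall (suc g)

mutual
  -- The number of up steps in the path after its first step; each stands for one entry of the
  -- permutation.
  sizeR : Rise g → ℕ
  sizeR (up c)   = suc (sizeR c)
  sizeR (turn c) = sizeF c

  sizeF : Fall g → ℕ
  sizeF stop      = 0
  sizeF (fall c)  = sizeF c
  sizeF (bump c)  = suc (sizeF c)
  sizeF (climb c) = suc (suc (sizeR c))

mutual
  allRise : (n g : ℕ) → List (Rise g)
  allRise zero    g = map turn (allFall zero g)
  allRise (suc n) g = map up (allRise n (suc g)) ++ map turn (allFall (suc n) g)

  allFall : (n g : ℕ) → List (Fall g)
  allFall zero          zero    = stop ∷ []
  allFall (suc n)       zero    = []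
  allFall zero          (suc g) = map fall (allFall zero g)
  allFall (suc zero)    (suc g) = map fall (allFall 1 g) ++ map bump (allFall 0 g)
  allFall (suc (suc n)) (suc g) =
    map fall (allFall (suc (suc n)) g) ++ map bump (allFall (suc n) g) ++ map climb (allRise n (suc (suc g)))

mutual
  ∈-allRise : (c : Rise g) → c ∈ allRise (sizeR c) g
  ∈-allRise (up c) = ∈-++⁺ˡ (∈-map⁺ up (∈-allRise c))
  ∈-allRise {g} (turn c) = lift (sizeF c) (∈-allFall c)
    where
    lift : ∀ n → c ∈ allFall n g → turn c ∈ allRise n g
    lift zero    p = ∈-map⁺ turn p
    lift (suc n) p = ∈-++⁺ʳ (map up (allRise n (suc g))) (∈-map⁺ turn p)

  ∈-allFall : (c : Fall g) → c ∈ allFall (sizeF c) g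
  ∈-allFall stop = here refl
  ∈-allFall {suc g} (fall c) = lift (sizeF c) (∈-allFall c)
    where
    lift : ∀ n → c ∈ allFall n g → fall c ∈ allFall n (suc g)
    lift zero          p = ∈-map⁺ fall p
    lift (suc zero)    p = ∈-++⁺ˡ (∈-map⁺ fall p)
    lift (suc (suc n)) p = ∈-++⁺ˡ (∈-map⁺ fall p)
  ∈-allFall {suc g} (bump c) = lift (sizeF c) (∈-allFall c)
    where
    lift : ∀ n → c ∈ allFall n g → bump c ∈ allFall (suc n) (suc g)
    lift zero    p = ∈-++⁺ʳ (map fall (allFall 1 g)) (∈-map⁺ bump p)
    lift (suc n) p = ∈-++⁺ʳ (map fall (allFall (suc (suc n)) g)) (∈-++⁺ˡ (∈-map⁺ bump p))
  ∈-allFall {suc g} (climb c) =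
    ∈-++⁺ʳ (map fall (allFall (suc (suc (sizeR c))) g))
      (∈-++⁺ʳ (map bump (allFall (suc (sizeR c)) g)) (∈-map⁺ climb (∈-allRise c)))

mutual
  sizeR-all : ∀ n {c : Rise g} → c ∈ allRise n g → sizeR c ≡ n
  sizeR-all zero p with _ , q , refl ← ∈-map⁻ turn p = sizeF-all zero q
  sizeR-all {g} (suc n) p with ∈-++⁻ (map up (allRise n (suc g))) p
  ... | inj₁ p₁ with _ , q , refl ← ∈-map⁻ up p₁   = cong suc (sizeR-all n q)
  ... | inj₂ p₂ with _ , q , refl ← ∈-map⁻ turn p₂ = sizeF-all (suc n) q

  sizeF-all : ∀ n {c : Fall g} → c ∈ allFall n g → sizeF c ≡ n
  sizeF-all {zero}  zero (here refl) = refl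
  sizeF-all {suc g} zero p with _ , q , refl ← ∈-map⁻ fall p = sizeF-all zero q
  sizeF-all {suc g} (suc zero) p with ∈-++⁻ (map fall (allFall 1 g)) p
  ... | inj₁ p₁ with _ , q , refl ← ∈-map⁻ fall p₁ = sizeF-all 1 q
  ... | inj₂ p₂ with _ , q , refl ← ∈-map⁻ bump p₂ = cong suc (sizeF-all 0 q)
  sizeF-all {suc g} (suc (suc n)) p with ∈-++⁻ (map fall (allFall (suc (suc n)) g)) p
  ... | inj₁ p₁ with _ , q , refl ← ∈-map⁻ fall p₁ = sizeF-all (suc (suc n)) q
  ... | inj₂ p₂ with ∈-++⁻ (map bump (allFall (suc n) g)) p₂
  ...   | inj₁ p₃ with _ , q , refl ← ∈-map⁻ bump p₃  = cong suc (sizeF-all (suc n) q)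
  ...   | inj₂ p₄ with _ , q , refl ← ∈-map⁻ climb p₄ = cong (2 +_) (sizeR-all n q)

mutual
  allRise-unique : ∀ n g → Unique (allRise n g)
  allRise-unique zero    g = Unique.map⁺ (λ { refl → refl }) (allFall-unique zero g)
  allRise-unique (suc n) g = Unique.++⁺
    (Unique.map⁺ (λ { refl → refl }) (allRise-unique n (suc g)))
    (Unique.map⁺ (λ { refl → refl }) (allFall-unique (suc n) g))
    λ (p , q) → case (∈-map⁻ up p) (∈-map⁻ turn q)
    where
    case : ∀ {c} → (∃ λ a → a ∈ allRise n (suc g) × c ≡ up a) → (∃ λ b → b ∈ allFall (suc n) g × c ≡ turn b) → ⊥
    case (_ , _ , refl) (_ , _ , ())

  allFall-unique : ∀ n g → Unique (allFall n g)
  allFall-unique zero          zero    = [] ∷ []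
  allFall-unique (suc n)       zero    = []
  allFall-unique zero          (suc g) = Unique.map⁺ (λ { refl → refl }) (allFall-unique zero g)
  allFall-unique (suc zero)    (suc g) = Unique.++⁺
    (Unique.map⁺ (λ { refl → refl }) (allFall-unique 1 g))
    (Unique.map⁺ (λ { refl → refl }) (allFall-unique 0 g))
    λ (p , q) → case (∈-map⁻ fall p) (∈-map⁻ bump q)
    where
    case : ∀ {c} → (∃ λ a → a ∈ allFall 1 g × c ≡ fall a) → (∃ λ b → b ∈ allFall 0 g × c ≡ bump b) → ⊥
    case (_ , _ , refl) (_ , _ , ())
  allFall-unique (suc (suc n)) (suc g) = Unique.++⁺
    (Unique.map⁺ (λ { refl → refl }) (allFall-unique (suc (suc n)) g))
    (Unique.++⁺
      (Unique.map⁺ (λ { refl → refl }) (allFall-unique (suc n) g))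
      (Unique.map⁺ (λ { refl → refl }) (allRise-unique n (suc (suc g))))
      λ (p , q) → case (∈-map⁻ bump p) (∈-map⁻ climb q))
    λ (p , q) → case′ (∈-map⁻ fall p) (∈-++⁻ (map bump (allFall (suc n) g)) q)
    where
    case : ∀ {c} → (∃ λ a → a ∈ allFall (suc n) g × c ≡ bump a) →
      (∃ λ b → b ∈ allRise n (suc (suc g)) × c ≡ climb b) → ⊥
    case (_ , _ , refl) (_ , _ , ())
    case′ : ∀ {c} → (∃ λ a → a ∈ allFall (suc (suc n)) g × c ≡ fall a) →
      c ∈ map bump (allFall (suc n) g) ⊎ c ∈ map climb (allRise n (suc (suc g))) → ⊥
    case′ (_ , _ , refl) (inj₁ p) with _ , _ , () ← ∈-map⁻ bump p
    case′ (_ , _ , refl) (inj₂ p) with _ , _ , () ← ∈-map⁻ climb p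

-- Dyck words of codes

mutual
  wordR : Rise g → List Step
  wordR (up c)   = u ∷ wordR c
  wordR (turn c) = wordF c

  wordF : Fall g → List Step
  wordF stop      = []
  wordF (fall c)  = d ∷ wordF c
  wordF (bump c)  = d ∷ u ∷ d ∷ wordF c
  wordF (climb c) = d ∷ u ∷ u ∷ wordR c

dyckWord : Rise 1 → List Step
dyckWord c = u ∷ wordR c

wordF≢u : ∀ (c : Fall g) {w} → wordF c ≢ u ∷ w
wordF≢u stop      ()
wordF≢u (fall c)  ()
wordF≢u (bump c)  ()
wordF≢u (climb c) ()

mutual
  -- No fall word starts with `u`. So after a `d` the next letter separates `fall` from the other
  -- two, and the letter after that separates `bump` from `climb`.
  wordR-injective : (c c′ : Rise g) → wordR c ≡ wordR c′ → c ≡ c′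
  wordR-injective (up c)   (up c′)   eq = cong up (wordR-injective c c′ (∷-injectiveʳ eq))
  wordR-injective (up c)   (turn c′) eq = contradiction (sym eq) (wordF≢u c′)
  wordR-injective (turn c) (up c′)   eq = contradiction eq (wordF≢u c)
  wordR-injective (turn c) (turn c′) eq = cong turn (wordF-injective c c′ eq)

  wordF-injective : (c c′ : Fall g) → wordF c ≡ wordF c′ → c ≡ c′
  wordF-injective stop      stop       eq = refl
  wordF-injective (fall c)  (fall c′)  eq = cong fall (wordF-injective c c′ (∷-injectiveʳ eq))
  wordF-injective (fall c)  (bump c′)  eq = contradiction (∷-injectiveʳ eq) (wordF≢u c)
  wordF-injective (fall c)  (climb c′) eq = contradiction (∷-injectiveʳ eq) (wordF≢u c)
  wordF-injective (bump c)  (fall c′)  eq = contradiction (sym (∷-injectiveʳ eq)) (wordF≢u c′)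
  wordF-injective (bump c)  (bump c′)  eq =
    cong bump (wordF-injective c c′ (∷-injectiveʳ (∷-injectiveʳ (∷-injectiveʳ eq))))
  wordF-injective (bump c)  (climb c′) ()
  wordF-injective (climb c) (fall c′)  eq = contradiction (sym (∷-injectiveʳ eq)) (wordF≢u c′)
  wordF-injective (climb c) (bump c′)  ()
  wordF-injective (climb c) (climb c′) eq =
    cong climb (wordR-injective c c′ (∷-injectiveʳ (∷-injectiveʳ (∷-injectiveʳ eq))))

dudu : List Step
dudu = d ∷ u ∷ d ∷ u ∷ []

mutual
  -- Every `du` comes from a `bump` or a `climb`. The latter reads `duu`, and the `dud` of the
  -- former is followed by a fall word, which never starts with `u`.
  wordR-dudu : (c : Rise g) → ¬ HasFactor (wordR c) dudu
  wordR-dudu (up c)   (here (() ∷ _))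
  wordR-dudu (up c)   (there i) = wordR-dudu c i
  wordR-dudu (turn c) i         = wordF-dudu c i

  wordF-dudu : (c : Fall g) → ¬ HasFactor (wordF c) dudu
  wordF-dudu stop     (here ())
  wordF-dudu (fall c) i = dword-dudu c i
  wordF-dudu (bump c) (here (_ ∷ _ ∷ _ ∷ p)) = ¬u-prefix c p
  wordF-dudu (bump c) (there (here (() ∷ _)))
  wordF-dudu (bump c) (there (there i)) = dword-dudu c i
  wordF-dudu (climb c) (here (_ ∷ _ ∷ () ∷ _))
  wordF-dudu (climb c) (there (here (() ∷ _)))
  wordF-dudu (climb c) (there (there (here (() ∷ _))))
  wordF-dudu (climb c) (there (there (there i))) = wordR-dudu c i

  dword-dudu : (c : Fall g) → ¬ HasFactor (d ∷ wordF c) dudu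
  dword-dudu c (here (_ ∷ p)) = ¬u-prefix c p
  dword-dudu c (there i)      = wordF-dudu c i

  ¬u-prefix : ∀ (c : Fall g) {v} → ¬ Prefix _≡_ (u ∷ v) (wordF c)
  ¬u-prefix (fall c)  (() ∷ _)
  ¬u-prefix (bump c)  (() ∷ _)
  ¬u-prefix (climb c) (() ∷ _)

-- Words leading from height `g` to the axis without passing below it; this replaces the integer
-- conditions of `IsDyckPath` by an inductive form.
data Path : ℕ → List Step → Set where
  []  : Path 0 []
  u∷_ : ∀ {w} → Path (suc g) w → Path g (u ∷ w)
  d∷_ : ∀ {w} → Path g w → Path (suc g) (d ∷ w)

mutual
  wordR-path : (c : Rise g) → Path g (wordR c)
  wordR-path (up c)   = u∷ wordR-path c
  wordR-path (turn c) = wordF-path c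

  wordF-path : (c : Fall g) → Path g (wordF c)
  wordF-path stop      = []
  wordF-path (fall c)  = d∷ wordF-path c
  wordF-path (bump c)  = d∷ u∷ d∷ wordF-path c
  wordF-path (climb c) = d∷ u∷ u∷ wordR-path c

mutual
  wordR-length : (c : Rise g) → length (wordR c) ≡ g + 2 * sizeR c
  wordR-length {g} (up c) = trans (cong suc (wordR-length c)) (lemma g (sizeR c))
    where
    lemma : ∀ g s → suc (suc g + 2 * s) ≡ g + 2 * suc s
    lemma = solve-∀
  wordR-length (turn c) = wordF-length c

  wordF-length : (c : Fall g) → length (wordF c) ≡ g + 2 * sizeF c
  wordF-length stop     = refl
  wordF-length (fall c) = cong suc (wordF-length c)
  wordF-length {suc g} (bump c) = trans (cong (3 +_) (wordF-length c)) (lemma g (sizeF c))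
    where
    lemma : ∀ g s → 3 + (g + 2 * s) ≡ suc g + 2 * suc s
    lemma = solve-∀
  wordF-length {suc g} (climb c) = trans (cong (3 +_) (wordR-length c)) (lemma g (sizeR c))
    where
    lemma : ∀ g s → 3 + (suc (suc g) + 2 * s) ≡ suc g + 2 * suc (suc s)
    lemma = solve-∀

mutual
  -- After a `d`, the end of the word or another `d` gives `fall`, `uu` gives `climb`, and `ud`
  -- gives `bump` unless a `u` follows. That last case is the only one without a code, and it
  -- completes `dudu`.
  parseR : ∀ {w} → Path g w → ¬ HasFactor w dudu → ∃ λ (c : Rise g) → wordR c ≡ w
  parseR (u∷ p) ¬f = let c , eq = parseR p (¬f ∘ there) in up c , cong (u ∷_) eq
  parseR []     ¬f = turn stop , refl
  parseR (d∷ p) ¬f = let c , eq = parseF p ¬f in turn c , eq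

  parseF : ∀ {w} → Path g w → ¬ HasFactor (d ∷ w) dudu → ∃ λ (c : Fall (suc g)) → wordF c ≡ d ∷ w
  parseF []          ¬f = fall stop , refl
  parseF (d∷ p)      ¬f = let c , eq = parseF p (¬f ∘ there) in fall c , cong (d ∷_) eq
  parseF (u∷ (u∷ p)) ¬f =
    let c , eq = parseR p (λ i → ¬f (there (there (there i)))) in climb c , cong (λ w → d ∷ u ∷ u ∷ w) eq
  parseF (u∷ (d∷ [])) ¬f = bump stop , refl
  parseF (u∷ (d∷ (d∷ p))) ¬f =
    let c , eq = parseF p (λ i → ¬f (there (there (there i)))) in bump c , cong (λ w → d ∷ u ∷ d ∷ w) eq
  parseF (u∷ (d∷ (u∷ p))) ¬f = contradiction (here (refl ∷ refl ∷ refl ∷ refl ∷ [])) ¬f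

path-height : ∀ {w} → Path g w → ℤ.+ g ℤ.+ height w ≡ 0ℤ
path-height []         = refl
path-height {g} (u∷_ {w = w} p) =
  trans (sym (ℤ.+-assoc (ℤ.+ g) 1ℤ (height w)))
  (trans (cong (λ k → ℤ.+ k ℤ.+ height w) (+-comm g 1)) (path-height p))
path-height {suc g} (d∷_ {w = w} p) =
  trans (sym (ℤ.+-assoc (ℤ.+ suc g) -1ℤ (height w))) (path-height p)

path-nonnegative : ∀ {w} → Path g w → ∀ v v′ → v ++ v′ ≡ w → 0ℤ ℤ.≤ ℤ.+ g ℤ.+ height v
path-nonnegative p [] v′ eq = ℤ.+≤+ z≤n
path-nonnegative {g} (u∷ p) (u ∷ v) v′ refl =
  subst (0ℤ ℤ.≤_) (trans (cong (λ k → ℤ.+ k ℤ.+ height v) (+-comm 1 g)) (ℤ.+-assoc (ℤ.+ g) 1ℤ (height v)))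
    (path-nonnegative p v v′ refl)
path-nonnegative {suc g} (d∷ p) (d ∷ v) v′ refl =
  subst (0ℤ ℤ.≤_) (ℤ.+-assoc (ℤ.+ suc g) -1ℤ (height v)) (path-nonnegative p v v′ refl)

toPath : ∀ g w → ℤ.+ g ℤ.+ height w ≡ 0ℤ →
  (∀ v v′ → v ++ v′ ≡ w → 0ℤ ℤ.≤ ℤ.+ g ℤ.+ height v) → Path g w
toPath zero    []      eq nn = []
toPath (suc g) []      () nn
toPath g       (u ∷ w) eq nn = u∷ toPath (suc g) w (trans (move w) eq)
  λ v v′ e → subst (0ℤ ℤ.≤_) (sym (move v)) (nn (u ∷ v) v′ (cong (u ∷_) e))
  where
  move : ∀ v → ℤ.+ suc g ℤ.+ height v ≡ ℤ.+ g ℤ.+ height (u ∷ v)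
  move v = trans (cong (λ k → ℤ.+ k ℤ.+ height v) (+-comm 1 g)) (ℤ.+-assoc (ℤ.+ g) 1ℤ (height v))
toPath zero    (d ∷ w) eq nn with () ← nn (d ∷ []) w refl
toPath (suc g) (d ∷ w) eq nn = d∷ toPath g w (trans (move w) eq)
  λ v v′ e → subst (0ℤ ℤ.≤_) (sym (move v)) (nn (d ∷ v) v′ (cong (d ∷_) e))
  where
  move : ∀ v → ℤ.+ g ℤ.+ height v ≡ ℤ.+ suc g ℤ.+ height (d ∷ v)
  move v = ℤ.+-assoc (ℤ.+ suc g) -1ℤ (height v)

-- Counting through an injective encoding

card-image : {A C : Set} {P : A → Set} (f : C → A) (cs : List C) → Unique cs →
  (∀ {c c′} → f c ≡ f c′ → c ≡ c′) → (∀ {c} → c ∈ cs → P (f c)) →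
  (∀ {a} → P a → ∃ λ c → c ∈ cs × f c ≡ a) → HasCardinality P (length cs)
card-image {P = P} f cs uq inj sound complete = record
  { elements    = map f cs
  ; unique      = Unique.map⁺ inj uq
  ; ∈-elements⇔ = λ a → mk⇔
      (λ p → let c , c∈ , eq = ∈-map⁻ f p in subst P (sym eq) (sound c∈))
      (λ Pa → let c , c∈ , eq = complete Pa in subst (_∈ map f cs) eq (∈-map⁺ f c∈))
  ; size        = length-map f cs
  }

dyck-card : ∀ n → HasCardinality (DyckAvoidingFactor (suc n) dudu) (length (allRise n 1))
dyck-card n = card-image dyckWord (allRise n 1) (allRise-unique n 1)
  (λ {c} {c′} eq → wordR-injective c c′ (∷-injectiveʳ eq)) sound complete
  where
  sound : ∀ {c} → c ∈ allRise n 1 → DyckAvoidingFactor (suc n) dudu (dyckWord c)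
  sound {c} c∈ = record
    { steps = trans (cong suc (wordR-length c)) (trans (lemma (sizeR c)) (cong (λ k → 2 * suc k) (sizeR-all n c∈)))
    ; endsOnAxis = trans (sym (ℤ.+-identityˡ _)) (path-height p)
    ; nonnegative = λ v v′ e → subst (0ℤ ℤ.≤_) (ℤ.+-identityˡ _) (path-nonnegative p v v′ e)
    } , λ { (here (() ∷ _)) ; (there i) → wordR-dudu c i }
    where
    p : Path 0 (dyckWord c)
    p = u∷ wordR-path c
    lemma : ∀ s → suc (1 + 2 * s) ≡ 2 * suc s
    lemma = solve-∀
  complete : ∀ {w} → DyckAvoidingFactor (suc n) dudu w → ∃ λ c → c ∈ allRise n 1 × dyckWord c ≡ w
  complete {w} (isDyck , ¬f) with toPath 0 w (trans (ℤ.+-identityˡ _) endsOnAxis)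
      (λ v v′ e → subst (0ℤ ℤ.≤_) (sym (ℤ.+-identityˡ _)) (nonnegative v v′ e))
    where open IsDyckPath isDyck
  ... | [] with () ← IsDyckPath.steps isDyck
  ... | u∷ p with c , refl ← parseR p (¬f ∘ there) = c , subst (λ k → c ∈ allRise k 1) size (∈-allRise c) , refl
    where
    lemma : ∀ s → suc (1 + 2 * s) ≡ 2 * suc s
    lemma = solve-∀
    size : sizeR c ≡ n
    size = suc-injective (*-cancelˡ-≡ _ _ 2
      (trans (sym (lemma (sizeR c))) (trans (cong suc (sym (wordR-length c))) (IsDyckPath.steps isDyck))))

⊆-++⁻ : ∀ {A : Set} (xs : List A) {ys zs} → zs ⊆ xs ++ ys →
  ∃₂ λ zs₁ zs₂ → zs ≡ zs₁ ++ zs₂ × zs₁ ⊆ xs × zs₂ ⊆ ys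
⊆-++⁻ []       τ           = [] , _ , refl , [] , τ
⊆-++⁻ (x ∷ xs) (.x ∷ʳ τ)   = let zs₁ , zs₂ , eq , τ₁ , τ₂ = ⊆-++⁻ xs τ in zs₁ , zs₂ , eq , x ∷ʳ τ₁ , τ₂
⊆-++⁻ (x ∷ xs) (refl ∷ τ)  =
  let zs₁ , zs₂ , eq , τ₁ , τ₂ = ⊆-++⁻ xs τ in x ∷ zs₁ , zs₂ , cong (x ∷_) eq , refl ∷ τ₁ , τ₂

-- Occurrences of 21, 132 and 321

<⇔< : ∀ {a b x y} → a < b → x < y → a < b ⇔ x < y
<⇔< p q = mk⇔ (λ _ → q) (λ _ → p)

≮⇔≮ : ∀ {a b x y} → b ≤ a → y ≤ x → a < b ⇔ x < y
≮⇔≮ p q = mk⇔ (λ r → contradiction r (≤⇒≯ p)) (λ r → contradiction r (≤⇒≯ q))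

contains-21 : ∀ {s} → Contains s (2 ∷ 1 ∷ []) ⇔ (∃₂ λ a b → a ∷ b ∷ [] ⊆ s × b < a)
contains-21 = mk⇔ to from
  where
  to : ∀ {s} → Contains s (2 ∷ 1 ∷ []) → ∃₂ λ a b → a ∷ b ∷ [] ⊆ s × b < a
  to (a ∷ b ∷ [] , τ , _ , iso) = a , b , τ , Equivalence.from (iso (suc zero) zero) ≤-refl
  from : ∀ {s} → (∃₂ λ a b → a ∷ b ∷ [] ⊆ s × b < a) → Contains s (2 ∷ 1 ∷ [])
  from (a , b , τ , b<a) = _ , τ , refl , λ where
    zero       zero       → ≮⇔≮ ≤-refl ≤-refl
    zero       (suc zero) → ≮⇔≮ (<⇒≤ b<a) (n≤1+n 1)
    (suc zero) zero       → <⇔< b<a (n<1+n 1)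
    (suc zero) (suc zero) → ≮⇔≮ ≤-refl ≤-refl

Occurrence : Word → (ℕ → ℕ → ℕ → Set) → Set
Occurrence s R = ∃ λ a → ∃₂ λ b c → a ∷ b ∷ c ∷ [] ⊆ s × R a b c

contains-132 : ∀ {s} → Contains s (1 ∷ 3 ∷ 2 ∷ []) ⇔ Occurrence s (λ a b c → a < c × c < b)
contains-132 = mk⇔ to from
  where
  to : ∀ {s} → Contains s (1 ∷ 3 ∷ 2 ∷ []) → Occurrence s (λ a b c → a < c × c < b)
  to (a ∷ b ∷ c ∷ [] , τ , _ , iso) = a , b , c , τ ,
    Equivalence.from (iso zero (suc (suc zero))) (n<1+n 1) ,
    Equivalence.from (iso (suc (suc zero)) (suc zero)) (n<1+n 2)
  from : ∀ {s} → Occurrence s (λ a b c → a < c × c < b) → Contains s (1 ∷ 3 ∷ 2 ∷ [])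
  from (a , b , c , τ , a<c , c<b) = _ , τ , refl , λ where
    zero             zero             → ≮⇔≮ ≤-refl ≤-refl
    zero             (suc zero)       → <⇔< (<-trans a<c c<b) (m≤m+n 2 1)
    zero             (suc (suc zero)) → <⇔< a<c (m≤m+n 2 0)
    (suc zero)       zero             → ≮⇔≮ (<⇒≤ (<-trans a<c c<b)) (m≤m+n 1 2)
    (suc zero)       (suc zero)       → ≮⇔≮ ≤-refl ≤-refl
    (suc zero)       (suc (suc zero)) → ≮⇔≮ (<⇒≤ c<b) (m≤m+n 2 1)
    (suc (suc zero)) zero             → ≮⇔≮ (<⇒≤ a<c) (m≤m+n 1 1)
    (suc (suc zero)) (suc zero)       → <⇔< c<b (m≤m+n 3 0)
    (suc (suc zero)) (suc (suc zero)) → ≮⇔≮ ≤-refl ≤-refl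

contains-321 : ∀ {s} → Contains s (3 ∷ 2 ∷ 1 ∷ []) ⇔ Occurrence s (λ a b c → c < b × b < a)
contains-321 = mk⇔ to from
  where
  to : ∀ {s} → Contains s (3 ∷ 2 ∷ 1 ∷ []) → Occurrence s (λ a b c → c < b × b < a)
  to (a ∷ b ∷ c ∷ [] , τ , _ , iso) = a , b , c , τ ,
    Equivalence.from (iso (suc (suc zero)) (suc zero)) (n<1+n 1) ,
    Equivalence.from (iso (suc zero) zero) (n<1+n 2)
  from : ∀ {s} → Occurrence s (λ a b c → c < b × b < a) → Contains s (3 ∷ 2 ∷ 1 ∷ [])
  from (a , b , c , τ , c<b , b<a) = _ , τ , refl , λ where
    zero             zero             → ≮⇔≮ ≤-refl ≤-refl
    zero             (suc zero)       → ≮⇔≮ (<⇒≤ b<a) (m≤m+n 2 1)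
    zero             (suc (suc zero)) → ≮⇔≮ (<⇒≤ (<-trans c<b b<a)) (m≤m+n 1 2)
    (suc zero)       zero             → <⇔< b<a (m≤m+n 3 0)
    (suc zero)       (suc zero)       → ≮⇔≮ ≤-refl ≤-refl
    (suc zero)       (suc (suc zero)) → ≮⇔≮ (<⇒≤ c<b) (m≤m+n 1 1)
    (suc (suc zero)) zero             → <⇔< (<-trans c<b b<a) (m≤m+n 2 1)
    (suc (suc zero)) (suc zero)       → <⇔< c<b (m≤m+n 2 0)
    (suc (suc zero)) (suc (suc zero)) → ≮⇔≮ ≤-refl ≤-refl

-- Stack-sorting machines

process-push : ∀ {T t st a} v → All (Avoids (a ∷ t ∷ st)) T →
  process T (t ∷ st) (a ∷ v) ≡ process T (a ∷ t ∷ st) v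
process-push {T} {t} {st} {a} v av
  rewrite dec-true (All.all? (avoids? (a ∷ t ∷ st)) T) av = refl

process-pop : ∀ {T t st a} v → ¬ All (Avoids (a ∷ t ∷ st)) T →
  process T (t ∷ st) (a ∷ v) ≡ t ∷ process T st (a ∷ v)
process-pop {T} {t} {st} {a} v ¬av
  rewrite dec-false (All.all? (avoids? (a ∷ t ∷ st)) T) ¬av = refl

-- The graph of `process`: induction on it exposes pushes and pops without the Boolean test.
data Run (T : List Word) : Word → Word → Word → Set where
  done  : ∀ {st} → Run T st [] st
  start : ∀ {a v y} → Run T (a ∷ []) v y → Run T [] (a ∷ v) y
  push  : ∀ {a t st v y} → All (Avoids (a ∷ t ∷ st)) T → Run T (a ∷ t ∷ st) v y → Run T (t ∷ st) (a ∷ v) y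
  pop   : ∀ {a t st v y} → ¬ All (Avoids (a ∷ t ∷ st)) T → Run T st (a ∷ v) y → Run T (t ∷ st) (a ∷ v) (t ∷ y)

process-run : ∀ T st v → Run T st v (process T st v)
process-run T []       []      = done
process-run T (t ∷ st) []      = done
process-run T []       (a ∷ v) = start (process-run T (a ∷ []) v)
process-run T (t ∷ st) (a ∷ v) =
  branch (All.all? (avoids? (a ∷ t ∷ st)) T) (process-run T (a ∷ t ∷ st) v) (process-run T st (a ∷ v))
  where
  branch : ∀ {y y′} (av? : Dec (All (Avoids (a ∷ t ∷ st)) T)) → Run T (a ∷ t ∷ st) v y → Run T st (a ∷ v) y′ →
    Run T (t ∷ st) (a ∷ v) (if does av? then y else t ∷ y′)
  branch (yes av) r _ = push av r
  branch (no ¬av) _ r = pop ¬av r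

run-↭ : ∀ {T st v y} → Run T st v y → y ↭ st ++ v
run-↭ {st = st} done = subst (st ↭_) (sym (++-identityʳ st)) ↭-refl
run-↭ (start r)      = run-↭ r
run-↭ {v = a ∷ v} (push {t = t} {st} _ r) = ↭-trans (run-↭ r) (↭-sym (shift a (t ∷ st) v))
run-↭ (pop _ r)      = ↭-prep _ (run-↭ r)

process-↭ : ∀ T st v → process T st v ↭ st ++ v
process-↭ T st v = run-↭ (process-run T st v)

run-stack⊆ : ∀ {T st v y} → Run T st v y → st ⊆ y
run-stack⊆ done       = ⊆-refl
run-stack⊆ (start r)  = minimum _
run-stack⊆ (push _ r) = ∷ˡ⁻ (run-stack⊆ r)
run-stack⊆ (pop _ r)  = refl ∷ run-stack⊆ r

stack⊆process : ∀ T st v → st ⊆ process T st v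
stack⊆process T st v = run-stack⊆ (process-run T st v)

∈-process : ∀ T st v {a} → a ∈ st ++ v → a ∈ process T st v
∈-process T st v = ∈-resp-↭ (↭-sym (process-↭ T st v))

-- West's map

Increasing : Word → Set
Increasing s = ∀ {a b} → a ∷ b ∷ [] ⊆ s → a ≤ b

Avoids231 : Word → Set
Avoids231 y = ∀ {a b c} → a ∷ b ∷ c ∷ [] ⊆ y → c < a → a < b → ⊥

21-pattern : List Word
21-pattern = (2 ∷ 1 ∷ []) ∷ []

increasing-∷ : ∀ {t st} → (∀ {a} → a ∈ st → t ≤ a) → Increasing st → Increasing (t ∷ st)
increasing-∷ t≤ inc (_ ∷ʳ τ)   = inc τ
increasing-∷ t≤ inc (refl ∷ τ) = t≤ (to∈ τ)

increasing-head : ∀ {t st a} → Increasing (t ∷ st) → a ∈ t ∷ st → t ≤ a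
increasing-head inc (here refl) = ≤-refl
increasing-head inc (there p)   = inc (refl ∷ from∈ p)

increasing⇒avoids21 : ∀ {s} → Increasing s → All (Avoids s) 21-pattern
increasing⇒avoids21 inc = (λ c → let a , b , τ , b<a = Equivalence.to contains-21 c in ≤⇒≯ (inc τ) b<a) ∷ []

¬avoids21 : ∀ {t st a} → t < a → ¬ All (Avoids (a ∷ t ∷ st)) 21-pattern
¬avoids21 t<a (av ∷ []) = av (Equivalence.from contains-21 (_ , _ , refl ∷ refl ∷ minimum _ , t<a))

-- Stack entries precede the remaining input `y` in the original word, so an occurrence of 231 may
-- begin on the stack and end in `y`; this rules it out.
Blocks231 : Word → Word → Set
Blocks231 st y = ∀ {t b c} → t ∈ st → b ∷ c ∷ [] ⊆ y → c < t → t < b → ⊥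

increasing-push : ∀ {a t st} → All (Avoids (a ∷ t ∷ st)) 21-pattern → Increasing (t ∷ st) → Increasing (a ∷ t ∷ st)
increasing-push {a} {t} av inc with a ≤? t
... | yes a≤t = increasing-∷ (λ p → ≤-trans a≤t (increasing-head inc p)) inc
... | no  a≰t = contradiction av (¬avoids21 (≰⇒> a≰t))

increasing-pop : ∀ {a t st} → ¬ All (Avoids (a ∷ t ∷ st)) 21-pattern → Increasing (t ∷ st) → t < a
increasing-pop ¬av inc = ≰⇒> λ a≤t →
  ¬av (increasing⇒avoids21 (increasing-∷ (λ p → ≤-trans a≤t (increasing-head inc p)) inc))

increasing-singleton : ∀ {a} → Increasing (a ∷ [])
increasing-singleton (_ ∷ʳ ())
increasing-singleton (_ ∷ ())

-- While input remains, an entry `t` is popped only for a larger next entry. A `c` smaller than `t`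
-- still to come would then be output after `t`.
west-increasing⁻ : ∀ {st y z} → Run 21-pattern st y z → Increasing st → Increasing z → Avoids231 y × Blocks231 st y
west-increasing⁻ done inc _ = (λ ()) , λ _ ()
west-increasing⁻ (start r) _ res =
  let av , bl = west-increasing⁻ r increasing-singleton res in
  (λ { (_ ∷ʳ τ) → av τ ; (refl ∷ τ) → bl (here refl) τ }) , λ ()
west-increasing⁻ (push p r) inc res =
  let inc′ = increasing-push p (λ {_} → inc)
      av , bl = west-increasing⁻ r inc′ res in
  (λ { (_ ∷ʳ τ) → av τ ; (refl ∷ τ) → bl (here refl) τ }) ,
  λ { t∈ (_ ∷ʳ τ) → bl (there t∈) τ
    ; t∈ (refl ∷ τ) _ t<a → <⇒≱ t<a (increasing-head inc′ (there t∈)) }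
west-increasing⁻ (pop {st = st} p r) inc res =
  let av , bl = west-increasing⁻ r (inc ∘ (_ ∷ʳ_)) (res ∘ (_ ∷ʳ_)) in
  (λ {_} → av) ,
  λ { (here refl) τ c<t _ →
        <⇒≱ c<t (increasing-head res (there (∈-resp-↭ (↭-sym (run-↭ r)) (∈-++⁺ʳ st (to∈ (∷ˡ⁻ τ))))))
    ; (there t∈) τ → bl t∈ τ }

west-increasing⁺ : ∀ {st y z} → Run 21-pattern st y z → Increasing st → Avoids231 y → Blocks231 st y → Increasing z
west-increasing⁺ done inc av bl = inc
west-increasing⁺ (start r) inc av bl =
  west-increasing⁺ r increasing-singleton (av ∘ (_ ∷ʳ_)) λ { (here refl) τ → av (refl ∷ τ) }
west-increasing⁺ (push p r) inc av bl =
  west-increasing⁺ r (increasing-push p (λ {_} → inc)) (av ∘ (_ ∷ʳ_))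
    λ { (here refl) τ → av (refl ∷ τ) ; (there t∈) τ → bl t∈ (_ ∷ʳ τ) }
west-increasing⁺ (pop {a} {t} {st} {v} p r) inc av bl =
  increasing-∷ (λ q → t≤ (∈-++⁻ st (∈-resp-↭ (run-↭ r) q)))
    (west-increasing⁺ r (inc ∘ (_ ∷ʳ_)) (λ {_} → av) (bl ∘ there))
  where
  t<a = increasing-pop p (λ {_} → inc)
  t≤ : ∀ {c} → c ∈ st ⊎ c ∈ a ∷ v → t ≤ c
  t≤ (inj₁ q)           = increasing-head inc (there q)
  t≤ (inj₂ (here refl)) = <⇒≤ t<a
  t≤ (inj₂ (there q))   = ≮⇒≥ λ c<t → bl (here refl) (refl ∷ from∈ q) c<t t<a

increasing⇒allPairs : ∀ s → Increasing s → AllPairs _≤_ s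
increasing⇒allPairs []      inc = []
increasing⇒allPairs (a ∷ s) inc =
  All.tabulate (λ p → inc (refl ∷ from∈ p)) ∷ increasing⇒allPairs s (inc ∘ (a ∷ʳ_))

allPairs⇒increasing : ∀ {s} → AllPairs _≤_ s → Increasing s
allPairs⇒increasing (a≤ ∷ ps) (_ ∷ʳ τ)   = allPairs⇒increasing ps τ
allPairs⇒increasing (a≤ ∷ ps) (refl ∷ τ) = All.lookup a≤ (to∈ τ)

identity-allPairs : ∀ n → AllPairs _≤_ (identity n)
identity-allPairs n = AllPairs.map⁺ (AllPairs.applyUpTo⁺₁ id n λ i<j _ → s≤s (<⇒≤ i<j))

-- Two sorted rearrangements of the same entries coincide, so an increasing output is the identity;
-- with the two inductions above this is Knuth's criterion for stack-sortability.
west-sorts⇔ : ∀ {n y} → y ↭ identity n → west y ≡ identity n ⇔ Avoids231 y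
west-sorts⇔ {n} {y} y↭ = mk⇔ to from
  where
  to : west y ≡ identity n → Avoids231 y
  to eq = proj₁ (west-increasing⁻ (process-run _ [] y) (λ ())
    (subst Increasing (sym eq) (allPairs⇒increasing (identity-allPairs n))))
  from : Avoids231 y → west y ≡ identity n
  from av = Pointwise-≡⇒≡ (↗↭↗⇒≋ ≤-totalOrder
    (AllPairs⇒Sorted ≤-totalOrder
      (increasing⇒allPairs _ (west-increasing⁺ (process-run _ [] y) (λ ()) (λ {_} → av) λ ())))
    (AllPairs⇒Sorted ≤-totalOrder (identity-allPairs n))
    (↭⇒↭ₛ (↭-trans (process-↭ 21-pattern [] y) y↭)))

-- The (132,321)-machine

patterns : List Word
patterns = (1 ∷ 3 ∷ 2 ∷ []) ∷ (3 ∷ 2 ∷ 1 ∷ []) ∷ []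

run : Word → Word → Word
run = process patterns

sort : Word → Word
sort = stackSort patterns

-- Both patterns end in a descent `b c`; an entry `a` above such a descent completes 132 or 321
-- exactly if it lies outside the interval from `c` to `b`.
Legal : Word → Set
Legal s = ∀ {a b c} → a ∷ b ∷ c ∷ [] ⊆ s → c < b → a < c ⊎ b < a → ⊥

avoids⇒legal : ∀ {s} → All (Avoids s) patterns → Legal s
avoids⇒legal (av ∷ _)      τ c<b (inj₁ a<c) = av (Equivalence.from contains-132 (_ , _ , _ , τ , a<c , c<b))
avoids⇒legal (_ ∷ av ∷ []) τ c<b (inj₂ b<a) = av (Equivalence.from contains-321 (_ , _ , _ , τ , c<b , b<a))

legal⇒avoids : ∀ {s} → Legal s → All (Avoids s) patterns
legal⇒avoids lg =
  (λ c → let _ , _ , _ , τ , a<c , c<b = Equivalence.to contains-132 c in lg τ c<b (inj₁ a<c)) ∷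
  (λ c → let _ , _ , _ , τ , c<b , b<a = Equivalence.to contains-321 c in lg τ c<b (inj₂ b<a)) ∷ []

legal? : ∀ s → Dec (Legal s)
legal? s = map′ (λ av {_} → avoids⇒legal av) (λ lg → legal⇒avoids (λ {_} → lg)) (All.all? (avoids? s) patterns)

run-push : ∀ {a} st v → Legal (a ∷ st) → run st (a ∷ v) ≡ run (a ∷ st) v
run-push []       v lg = refl
run-push (t ∷ st) v lg = process-push v (legal⇒avoids (λ {_} → lg))

run-pop : ∀ {a t} st v → ¬ Legal (a ∷ t ∷ st) → run (t ∷ st) (a ∷ v) ≡ t ∷ run st (a ∷ v)
run-pop st v ¬lg = process-pop v (λ av → ¬lg (λ {_} → avoids⇒legal av))

-- The entries popped before `a` can be pushed, and the stack after the push. The stack is not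
-- emptied at the end, so that a word can be read piece by piece.
feed : Word → ℕ → Word × Word
feed []       a = [] , a ∷ []
feed (t ∷ st) a with legal? (a ∷ t ∷ st)
... | yes _ = [] , a ∷ t ∷ st
... | no  _ = let p , st′ = feed st a in t ∷ p , st′

feeds : Word → Word → Word × Word
feeds st []      = [] , st
feeds st (a ∷ v) = let p , st₁ = feed st a ; q , st₂ = feeds st₁ v in p ++ q , st₂

out stk : Word → Word
out w = proj₁ (feeds [] w)
stk w = proj₂ (feeds [] w)

run-feed : ∀ st a v → run st (a ∷ v) ≡ proj₁ (feed st a) ++ run (proj₂ (feed st a)) v
run-feed []       a v = refl
run-feed (t ∷ st) a v with legal? (a ∷ t ∷ st)
... | yes lg = run-push (t ∷ st) v (λ {_} → lg)
... | no ¬lg = trans (run-pop st v ¬lg) (cong (t ∷_) (run-feed st a v))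

run-feeds : ∀ st v w → run st (v ++ w) ≡ proj₁ (feeds st v) ++ run (proj₂ (feeds st v)) w
run-feeds st []      w = refl
run-feeds st (a ∷ v) w = let p , st₁ = feed st a in
  trans (run-feed st a (v ++ w)) (trans (cong (p ++_) (run-feeds st₁ v w)) (sym (++-assoc p _ _)))

feeds-++ : ∀ st v w → let p , st₁ = feeds st v ; q , st₂ = feeds st₁ w in feeds st (v ++ w) ≡ (p ++ q , st₂)
feeds-++ st []      w = refl
feeds-++ st (a ∷ v) w = let p , st₁ = feed st a in
  trans (cong (λ (q , st₂) → p ++ q , st₂) (feeds-++ st₁ v w))
    (cong (_, proj₂ (feeds (proj₂ (feeds st₁ v)) w)) (sym (++-assoc p _ _)))

sort-feeds : ∀ v → sort v ≡ out v ++ stk v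
sort-feeds v = trans (cong sort (sym (++-identityʳ v))) (run-feeds [] v [])

feeds-↭ : ∀ st v → proj₁ (feeds st v) ++ proj₂ (feeds st v) ↭ st ++ v
feeds-↭ st v = subst₂ _↭_ (run-feeds st v []) (cong (st ++_) (++-identityʳ v)) (process-↭ patterns st (v ++ []))

feed-↭ : ∀ st a → proj₁ (feed st a) ++ proj₂ (feed st a) ↭ st ++ a ∷ []
feed-↭ st a = subst (_↭ st ++ a ∷ []) (run-feed st a []) (process-↭ patterns st (a ∷ []))

-- The bottom entry m of the stack is invisible to the smaller entries above it: it can
-- only be the last, hence not the largest, letter of a forbidden pattern.

legal-bottom⁺ : ∀ {m s} → All (_< m) s → Legal s → Legal (s ++ m ∷ [])
legal-bottom⁺ {s = s} s<m lg τ with ⊆-++⁻ s τ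
... | _ ∷ _ ∷ _ ∷ [] , [] , refl , τ₁ , _ = lg τ₁
... | _ ∷ b ∷ [] , _ ∷ [] , refl , τ₁ , refl ∷ [] =
  λ m<b _ → <-asym m<b (All.lookup s<m (to∈ (∷ˡ⁻ τ₁)))
... | _ ∷ [] , _ ∷ _ ∷ [] , refl , _ , _ ∷ ()
... | _ ∷ [] , _ ∷ _ ∷ [] , refl , _ , _ ∷ʳ ()
... | [] , _ ∷ _ ∷ _ ∷ [] , refl , _ , _ ∷ ()
... | [] , _ ∷ _ ∷ _ ∷ [] , refl , _ , _ ∷ʳ ()

legal-⊆ : ∀ {s s′} → s ⊆ s′ → Legal s′ → Legal s
legal-⊆ σ lg τ = lg (⊆-trans τ σ)

feed-bottom : ∀ {m a} st → a < m → All (_< m) st →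
  feed (st ++ m ∷ []) a ≡ (proj₁ (feed st a) , proj₂ (feed st a) ++ m ∷ [])
feed-bottom {m} {a} [] a<m _ with legal? (a ∷ m ∷ [])
... | yes _  = refl
... | no ¬lg = ⊥-elim (¬lg λ { (_ ∷ _ ∷ ()) ; (_ ∷ _ ∷ʳ ()) ; (_ ∷ʳ _ ∷ ()) ; (_ ∷ʳ _ ∷ʳ ()) })
feed-bottom {m} {a} (t ∷ st) a<m (t<m ∷ st<m) with legal? (a ∷ t ∷ st) | legal? (a ∷ t ∷ st ++ m ∷ [])
... | yes _  | yes _  = refl
... | no  _  | no  _  = cong (λ (p , st′) → t ∷ p , st′) (feed-bottom st a<m st<m)
... | yes lg | no ¬lg = ⊥-elim (¬lg (legal-bottom⁺ (a<m ∷ t<m ∷ st<m) (λ {_} → lg)))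
... | no ¬lg | yes lg = ⊥-elim (¬lg (legal-⊆ (++⁺ʳ (m ∷ []) ⊆-refl) (λ {_} → lg)))

feeds-bottom : ∀ {m} st v → All (_< m) v → All (_< m) st →
  feeds (st ++ m ∷ []) v ≡ (proj₁ (feeds st v) , proj₂ (feeds st v) ++ m ∷ [])
feeds-bottom st []      _           _    = refl
feeds-bottom st (a ∷ v) (a<m ∷ v<m) st<m rewrite feed-bottom st a<m st<m
  | feeds-bottom (proj₂ (feed st a)) v v<m
      (All.++⁻ʳ (proj₁ (feed st a)) (All-resp-↭ (↭-sym (feed-↭ st a)) (All.++⁺ st<m (a<m ∷ [])))) = refl

-- Decoding codes into permutations

flat : Vec Word g → Word
flat []       = []
flat (b ∷ bs) = flat bs ++ b

-- The head of the vector is the rightmost block, so `▷` puts a block in front of the word.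
flat-▷ : ∀ (bs : Vec Word g) b → flat (bs ▷ b) ≡ b ++ flat bs
flat-▷ []        b = sym (++-identityʳ b)
flat-▷ (b′ ∷ bs) b = trans (cong (_++ b′) (flat-▷ bs b)) (++-assoc b (flat bs) b′)

-- The blocks bs of the current word are listed from right to left, with a good gap in front
-- of each; N is the least unused value.  In decodeF the new first entry is m, and z is the
-- part of the word, large entries included, to the right of the gaps still to be visited.

mutual
  decodeR : Vec Word g → ℕ → Rise g → Word
  decodeR bs N (up c)   = decodeR (bs ▷ (N ∷ [])) (suc N) c
  decodeR bs N (turn c) = decodeF bs N [] (suc N) c

  decodeF : Vec Word g → ℕ → Word → ℕ → Fall g → Word
  decodeF []       m z N stop      = m ∷ z
  decodeF (b ∷ bs) m z N (fall c)  = decodeF bs m (b ++ z) N c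
  decodeF (b ∷ bs) m z N (bump c)  = decodeF bs m (N ∷ b ++ z) (suc N) c
  -- No good gap is left to the right of the leftmost large entry `N`, so all of that part joins one
  -- block. The gap in front of `N` survives, and one in front of `m` is added.
  decodeF (b ∷ bs) m z N (climb c) = decodeR ((N ∷ b ++ z) ∷ (bs ▷ (m ∷ []))) (suc N) c

-- The empty word has one good gap, represented by one empty block.
decode : Rise 1 → Word
decode = decodeR ([] ∷ []) 1

-- Injectivity of decoding

flat-climb : ∀ (bs : Vec Word g) m z → flat (z ∷ (bs ▷ (m ∷ []))) ≡ m ∷ flat bs ++ z
flat-climb bs m z = cong (_++ z) (flat-▷ bs (m ∷ []))

skip-N : ∀ (bs : Vec Word g) b m z N → m ∷ (flat bs ++ b) ++ z ⊆ m ∷ flat bs ++ N ∷ b ++ z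
skip-N bs b m z N = ⊆-trans (⊆-reflexive (cong (m ∷_) (++-assoc (flat bs) b z)))
  (refl ∷ ++⁺ (⊆-refl {x = flat bs}) (N ∷ʳ ⊆-refl))

-- Later insertions do not change relative positions, so a code can be read off from the
-- position of each entry N among the smaller ones in the decoded permutation.

mutual
  ⊆-decodeR : ∀ (bs : Vec Word g) N c → N ∷ flat bs ⊆ decodeR bs N c
  ⊆-decodeR bs N (up c)   = ⊆-trans (⊆-reflexive (sym (flat-▷ bs (N ∷ []))))
    (∷ˡ⁻ (⊆-decodeR (bs ▷ (N ∷ [])) (suc N) c))
  ⊆-decodeR bs N (turn c) = ⊆-trans (⊆-reflexive (cong (N ∷_) (sym (++-identityʳ (flat bs)))))
    (⊆-decodeF bs N [] (suc N) c)

  ⊆-decodeF : ∀ (bs : Vec Word g) m z N c → m ∷ flat bs ++ z ⊆ decodeF bs m z N c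
  ⊆-decodeF []       m z N stop      = ⊆-refl
  ⊆-decodeF (b ∷ bs) m z N (fall c)  =
    ⊆-trans (⊆-reflexive (cong (m ∷_) (++-assoc (flat bs) b z))) (⊆-decodeF bs m (b ++ z) N c)
  ⊆-decodeF (b ∷ bs) m z N (bump c)  = ⊆-trans (skip-N bs b m z N) (⊆-decodeF bs m (N ∷ b ++ z) (suc N) c)
  ⊆-decodeF (b ∷ bs) m z N (climb c) = ⊆-trans (skip-N bs b m z N) (climb-⊆ bs b m z N c)

  climb-⊆ : ∀ (bs : Vec Word g) b m z N c → m ∷ flat bs ++ N ∷ b ++ z ⊆ decodeF (b ∷ bs) m z N (climb c)
  climb-⊆ bs b m z N c = ⊆-trans (⊆-reflexive (sym (flat-climb bs m (N ∷ b ++ z))))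
    (∷ˡ⁻ (⊆-decodeR ((N ∷ b ++ z) ∷ (bs ▷ (m ∷ []))) (suc N) c))

climb-head : ∀ (bs : Vec Word g) b m z N c → suc N ∷ m ∷ [] ⊆ decodeF (b ∷ bs) m z N (climb c)
climb-head bs b m z N c = ⊆-trans
  (subst (λ w → suc N ∷ m ∷ [] ⊆ suc N ∷ w) (sym (flat-climb bs m (N ∷ b ++ z))) (refl ∷ refl ∷ minimum _))
  (⊆-decodeR ((N ∷ b ++ z) ∷ (bs ▷ (m ∷ []))) (suc N) c)

-- The first `bump` or `climb` still to come inserts `N` into a gap behind `m`; with `fall` alone,
-- no further entry is inserted.
absent-or-after : ∀ (bs : Vec Word g) m z N c → All (_< N) (m ∷ z) → All (_< N) (flat bs) →
  N ∉ decodeF bs m z N c ⊎ m ∷ N ∷ [] ⊆ decodeF bs m z N c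
absent-or-after [] m z N stop <N _ = inj₁ λ p → <-irrefl refl (All.lookup <N p)
absent-or-after (b ∷ bs) m z N (fall c) (m<N ∷ z<N) bs<N =
  absent-or-after bs m (b ++ z) N c (m<N ∷ All.++⁺ (All.++⁻ʳ (flat bs) bs<N) z<N) (All.++⁻ˡ (flat bs) bs<N)
absent-or-after (b ∷ bs) m z N (bump c) _ _ =
  inj₂ (⊆-trans (refl ∷ ++⁺ˡ (flat bs) (refl ∷ minimum _)) (⊆-decodeF bs m (N ∷ b ++ z) (suc N) c))
absent-or-after (b ∷ bs) m z N (climb c) _ _ =
  inj₂ (⊆-trans (refl ∷ ++⁺ˡ (flat bs) (refl ∷ minimum _)) (climb-⊆ bs b m z N c))

-- Gaps are visited from right to left, so an insertion can only happen to the left of the finished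
-- part `z`.
absent-or-before-tail : ∀ (bs : Vec Word g) m z N c → All (_< N) (m ∷ z) → All (_< N) (flat bs) →
  N ∉ decodeF bs m z N c ⊎ N ∷ z ⊆ decodeF bs m z N c
absent-or-before-tail [] m z N stop <N _ = inj₁ λ p → <-irrefl refl (All.lookup <N p)
absent-or-before-tail (b ∷ bs) m z N (fall c) (m<N ∷ z<N) bs<N
  with absent-or-before-tail bs m (b ++ z) N c (m<N ∷ All.++⁺ (All.++⁻ʳ (flat bs) bs<N) z<N) (All.++⁻ˡ (flat bs) bs<N)
... | inj₁ N∉ = inj₁ N∉
... | inj₂ τ  = inj₂ (⊆-trans (refl ∷ ++⁺ˡ b ⊆-refl) τ)
absent-or-before-tail (b ∷ bs) m z N (bump c) _ _ =
  inj₂ (⊆-trans (m ∷ʳ ++⁺ˡ (flat bs) (refl ∷ ++⁺ˡ b ⊆-refl)) (⊆-decodeF bs m (N ∷ b ++ z) (suc N) c))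
absent-or-before-tail (b ∷ bs) m z N (climb c) _ _ =
  inj₂ (⊆-trans (m ∷ʳ ++⁺ˡ (flat bs) (refl ∷ ++⁺ˡ b ⊆-refl)) (climb-⊆ bs b m z N c))

absent-or-before-head : ∀ (bs : Vec Word g) b m z N c → All (_< N) (m ∷ z) → All (_< N) (flat (b ∷ bs)) →
  N ∉ decodeF (b ∷ bs) m z N c ⊎ N ∷ b ⊆ decodeF (b ∷ bs) m z N c
absent-or-before-head bs b m z N (fall c) (m<N ∷ z<N) bs<N
  with absent-or-before-tail bs m (b ++ z) N c (m<N ∷ All.++⁺ (All.++⁻ʳ (flat bs) bs<N) z<N) (All.++⁻ˡ (flat bs) bs<N)
... | inj₁ N∉ = inj₁ N∉
... | inj₂ τ  = inj₂ (⊆-trans (refl ∷ ++⁺ʳ z ⊆-refl) τ)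
absent-or-before-head bs b m z N (bump c) _ _ =
  inj₂ (⊆-trans (m ∷ʳ ++⁺ˡ (flat bs) (refl ∷ ++⁺ʳ z ⊆-refl)) (⊆-decodeF bs m (N ∷ b ++ z) (suc N) c))
absent-or-before-head bs b m z N (climb c) _ _ =
  inj₂ (⊆-trans (m ∷ʳ ++⁺ˡ (flat bs) (refl ∷ ++⁺ʳ z ⊆-refl)) (climb-⊆ bs b m z N c))

order-unique : ∀ {x : Word} {a b} → Unique x → a ∷ b ∷ [] ⊆ x → b ∷ a ∷ [] ⊆ x → ⊥
order-unique (_ ∷ uq)  (_ ∷ʳ τ)   (_ ∷ʳ τ′)  = order-unique uq τ τ′
order-unique (a≢ ∷ _)  (refl ∷ τ) (refl ∷ _) = All.lookup a≢ (to∈ τ) refl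
order-unique (a≢ ∷ uq) (refl ∷ τ) (_ ∷ʳ τ′)  = All.lookup a≢ (to∈ (∷ˡ⁻ τ′)) refl
order-unique (a≢ ∷ uq) (_ ∷ʳ τ)   (refl ∷ τ′) = All.lookup a≢ (to∈ (∷ˡ⁻ τ)) refl

-- An empty block stands for a gap at the right end of the word. All other blocks are nonempty, so
-- that any two listed gaps are separated by an entry.
Proper : Vec Word g → Set
Proper []       = ⊤
Proper (b ∷ bs) = VAll.All (_≢ []) bs

proper-tail : ∀ {bs : Vec Word g} → VAll.All (_≢ []) bs → Proper bs
proper-tail []        = tt
proper-tail (_ ∷ bs≢) = bs≢

all-▷ : ∀ {bs : Vec Word g} {a} → VAll.All (_≢ []) bs → VAll.All (_≢ []) (bs ▷ (a ∷ []))
all-▷ []         = (λ ()) ∷ []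
all-▷ (b≢ ∷ bs≢) = b≢ ∷ all-▷ bs≢

proper-▷ : ∀ (bs : Vec Word g) {a} → Proper bs → Proper (bs ▷ (a ∷ []))
proper-▷ []       _   = []
proper-▷ (b ∷ bs) bs≢ = all-▷ bs≢

<-all-suc : ∀ {x} → All (_< N) x → All (_< suc N) x
<-all-suc = All.map m<n⇒m<1+n

-- The place of `suc N` differs: after `up` it is the first entry of the next stage, before `N`;
-- after `turn` it is behind `N` or absent.
up≢turn : ∀ (bs : Vec Word g) N c c′ → All (_< N) (flat bs) → Unique (decodeR bs N (up c)) →
  decodeR bs N (up c) ≢ decodeR bs N (turn c′)
up≢turn bs N c c′ bs<N uq eq with absent-or-after bs N [] (suc N) c′ (n<1+n N ∷ []) (<-all-suc bs<N)
... | inj₁ N∉ = N∉ (subst (suc N ∈_) eq (to∈ (⊆-decodeR (bs ▷ (N ∷ [])) (suc N) c)))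
... | inj₂ τ  = order-unique uq (subst (N ∷ suc N ∷ [] ⊆_) (sym eq) τ)
  (⊆-trans (subst (λ w → suc N ∷ N ∷ [] ⊆ suc N ∷ w) (sym (flat-▷ bs (N ∷ []))) (refl ∷ refl ∷ minimum _))
    (⊆-decodeR (bs ▷ (N ∷ [])) (suc N) c))

-- Both put `N` into the same gap. They differ in `suc N`, which is before `m` after `climb`, and
-- behind `m` or absent after `bump`.
bump≢climb : ∀ (bs : Vec Word g) b m z N c c′ → All (_< N) (m ∷ z) → All (_< N) (flat (b ∷ bs)) →
  Unique (decodeF (b ∷ bs) m z N (bump c)) → decodeF (b ∷ bs) m z N (bump c) ≢ decodeF (b ∷ bs) m z N (climb c′)
bump≢climb bs b m z N c c′ (m<N ∷ z<N) bs<N uq eq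
  with absent-or-after bs m (N ∷ b ++ z) (suc N) c
         (m<n⇒m<1+n m<N ∷ n<1+n N ∷ <-all-suc (All.++⁺ (All.++⁻ʳ (flat bs) bs<N) z<N))
         (<-all-suc (All.++⁻ˡ (flat bs) bs<N))
... | inj₁ N∉ = N∉ (subst (suc N ∈_) (sym eq) (to∈ (climb-head bs b m z N c′)))
... | inj₂ τ  = order-unique uq τ (subst (suc N ∷ m ∷ [] ⊆_) (sym eq) (climb-head bs b m z N c′))

-- Once the gap is passed over, `N` is absent or goes further left, before the next block `b′`. In
-- `x`, as after `bump` or `climb`, it is behind `b′`, whose first entry shows the difference.
fall-distinct : ∀ (bs : Vec Word g) b m z N c {x} → VAll.All (_≢ []) bs →
  All (_< N) (m ∷ z) → All (_< N) (flat (b ∷ bs)) →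
  Unique x → m ∷ flat bs ++ N ∷ b ++ z ⊆ x → decodeF (b ∷ bs) m z N (fall c) ≢ x
fall-distinct [] b m z N stop _ (m<N ∷ z<N) b<N _ τ refl =
  <-irrefl refl (All.lookup {P = _< N} (m<N ∷ All.++⁺ b<N z<N) (to∈ (∷ˡ⁻ τ)))
fall-distinct (b′ ∷ bs) b m z N c (b′≢ ∷ _) (m<N ∷ z<N) bs<N uq τ refl
  with absent-or-before-head bs b′ m (b ++ z) N c
         (m<N ∷ All.++⁺ (All.++⁻ʳ (flat bs ++ b′) bs<N) z<N) (All.++⁻ˡ (flat bs ++ b′) bs<N)
... | inj₁ N∉ = N∉ (to∈ (⊆-trans (++⁺ˡ (m ∷ flat bs ++ b′) (refl ∷ minimum _)) τ))
fall-distinct (b′ ∷ bs) b m z N c (b′≢ ∷ _) (m<N ∷ z<N) bs<N uq τ refl | inj₂ τ′ with b′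
... | []     = b′≢ refl
... | e ∷ b₁ = order-unique uq (⊆-trans (refl ∷ refl ∷ minimum _) τ′)
  (⊆-trans (m ∷ʳ ++⁺ (++⁺ˡ (flat bs) (refl ∷ minimum _)) (refl ∷ minimum _)) τ)

mutual
  decodeR-injective : ∀ (bs : Vec Word g) N c c′ → Proper bs → All (_< N) (flat bs) → Unique (decodeR bs N c) →
    decodeR bs N c ≡ decodeR bs N c′ → c ≡ c′
  decodeR-injective bs N (up c) (up c′) bs≢ bs<N uq eq = cong up
    (decodeR-injective (bs ▷ (N ∷ [])) (suc N) c c′ (proper-▷ bs bs≢)
      (subst (All (_< suc N)) (sym (flat-▷ bs (N ∷ []))) (n<1+n N ∷ <-all-suc bs<N)) uq eq)
  decodeR-injective bs N (up c) (turn c′) bs≢ bs<N uq eq = contradiction eq (up≢turn bs N c c′ bs<N uq)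
  decodeR-injective bs N (turn c) (up c′) bs≢ bs<N uq eq =
    contradiction (sym eq) (up≢turn bs N c′ c bs<N (subst Unique eq uq))
  decodeR-injective bs N (turn c) (turn c′) bs≢ bs<N uq eq = cong turn
    (decodeF-injective bs N [] (suc N) c c′ bs≢ (n<1+n N ∷ []) (<-all-suc bs<N) uq eq)

  decodeF-injective : ∀ (bs : Vec Word g) m z N c c′ → Proper bs → All (_< N) (m ∷ z) → All (_< N) (flat bs) →
    Unique (decodeF bs m z N c) → decodeF bs m z N c ≡ decodeF bs m z N c′ → c ≡ c′
  decodeF-injective [] m z N stop stop _ _ _ _ _ = refl
  decodeF-injective (b ∷ bs) m z N (fall c) (fall c′) bs≢ (m<N ∷ z<N) bs<N uq eq = cong fall
    (decodeF-injective bs m (b ++ z) N c c′ (proper-tail bs≢)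
      (m<N ∷ All.++⁺ (All.++⁻ʳ (flat bs) bs<N) z<N) (All.++⁻ˡ (flat bs) bs<N) uq eq)
  decodeF-injective (b ∷ bs) m z N (bump c) (bump c′) bs≢ (m<N ∷ z<N) bs<N uq eq = cong bump
    (decodeF-injective bs m (N ∷ b ++ z) (suc N) c c′ (proper-tail bs≢)
      (m<n⇒m<1+n m<N ∷ n<1+n N ∷ <-all-suc (All.++⁺ (All.++⁻ʳ (flat bs) bs<N) z<N))
      (<-all-suc (All.++⁻ˡ (flat bs) bs<N)) uq eq)
  decodeF-injective (b ∷ bs) m z N (climb c) (climb c′) bs≢ (m<N ∷ z<N) bs<N uq eq = cong climb
    (decodeR-injective ((N ∷ b ++ z) ∷ (bs ▷ (m ∷ []))) (suc N) c c′ (all-▷ bs≢)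
      (subst (All (_< suc N)) (sym (flat-climb bs m (N ∷ b ++ z)))
        (m<n⇒m<1+n m<N ∷ All.++⁺ (<-all-suc (All.++⁻ˡ (flat bs) bs<N))
          (n<1+n N ∷ <-all-suc (All.++⁺ (All.++⁻ʳ (flat bs) bs<N) z<N)))) uq eq)
  decodeF-injective (b ∷ bs) m z N (fall c) (bump c′) bs≢ <N bs<N uq eq =
    contradiction eq (fall-distinct bs b m z N c bs≢ <N bs<N (subst Unique eq uq)
      (⊆-decodeF bs m (N ∷ b ++ z) (suc N) c′))
  decodeF-injective (b ∷ bs) m z N (fall c) (climb c′) bs≢ <N bs<N uq eq =
    contradiction eq (fall-distinct bs b m z N c bs≢ <N bs<N (subst Unique eq uq) (climb-⊆ bs b m z N c′))
  decodeF-injective (b ∷ bs) m z N (bump c) (fall c′) bs≢ <N bs<N uq eq =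
    contradiction (sym eq) (fall-distinct bs b m z N c′ bs≢ <N bs<N uq (⊆-decodeF bs m (N ∷ b ++ z) (suc N) c))
  decodeF-injective (b ∷ bs) m z N (climb c) (fall c′) bs≢ <N bs<N uq eq =
    contradiction (sym eq) (fall-distinct bs b m z N c′ bs≢ <N bs<N uq (climb-⊆ bs b m z N c))
  decodeF-injective (b ∷ bs) m z N (bump c) (climb c′) bs≢ <N bs<N uq eq =
    contradiction eq (bump≢climb bs b m z N c c′ <N bs<N uq)
  decodeF-injective (b ∷ bs) m z N (climb c) (bump c′) bs≢ <N bs<N uq eq =
    contradiction (sym eq) (bump≢climb bs b m z N c′ c <N bs<N (subst Unique eq uq))

-- Decoded words are permutations

identity-suc : ∀ n → identity (suc n) ≡ identity n ++ suc n ∷ []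
identity-suc n = trans (cong (map suc) (sym (upTo-∷ʳ n))) (map-++ suc (upTo n) (n ∷ []))

identity-insert : ∀ {n} v {w} → v ++ w ↭ identity n → v ++ suc n ∷ w ↭ identity (suc n)
identity-insert {n} v {w} p = ↭-trans (shift (suc n) v w)
  (↭-trans (↭-prep (suc n) p) (↭-trans (++-comm (suc n ∷ []) (identity n)) (↭-reflexive (sym (identity-suc n)))))

mutual
  -- The `suc` accounts for the first entry of the last stage, which `turn` introduces without
  -- adding to the size.
  decodeR-↭ : ∀ (bs : Vec Word g) n c → flat bs ↭ identity n → decodeR bs (suc n) c ↭ identity (suc n + sizeR c)
  decodeR-↭ bs n (up c) p = subst (λ k → decodeR bs (suc n) (up c) ↭ identity k) (sym (+-suc (suc n) (sizeR c)))
    (decodeR-↭ (bs ▷ (suc n ∷ [])) (suc n) c (subst (_↭ _) (sym (flat-▷ bs (suc n ∷ []))) (identity-insert [] p)))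
  decodeR-↭ bs n (turn c) p = decodeF-↭ bs (suc n) [] (suc n) c
    (subst (λ w → suc n ∷ w ↭ _) (sym (++-identityʳ (flat bs))) (identity-insert [] p))

  decodeF-↭ : ∀ (bs : Vec Word g) m z n c → m ∷ flat bs ++ z ↭ identity n →
    decodeF bs m z (suc n) c ↭ identity (n + sizeF c)
  decodeF-↭ [] m z n stop p = subst (λ k → m ∷ z ↭ identity k) (sym (+-identityʳ n)) p
  decodeF-↭ (b ∷ bs) m z n (fall c) p =
    decodeF-↭ bs m (b ++ z) n c (subst (λ w → m ∷ w ↭ _) (++-assoc (flat bs) b z) p)
  decodeF-↭ (b ∷ bs) m z n (bump c) p =
    subst (λ k → decodeF (b ∷ bs) m z (suc n) (bump c) ↭ identity k) (sym (+-suc n (sizeF c)))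
    (decodeF-↭ bs m (suc n ∷ b ++ z) (suc n) c
      (identity-insert (m ∷ flat bs) (subst (λ w → m ∷ w ↭ _) (++-assoc (flat bs) b z) p)))
  decodeF-↭ (b ∷ bs) m z n (climb c) p =
    subst (λ k → decodeF (b ∷ bs) m z (suc n) (climb c) ↭ identity k)
      (sym (trans (+-suc n (suc (sizeR c))) (cong suc (+-suc n (sizeR c)))))
    (decodeR-↭ ((suc n ∷ b ++ z) ∷ (bs ▷ (m ∷ []))) (suc n) c
      (subst (_↭ _) (sym (flat-climb bs m (suc n ∷ b ++ z)))
        (identity-insert (m ∷ flat bs) (subst (λ w → m ∷ w ↭ _) (++-assoc (flat bs) b z) p))))

identity-unique : ∀ n → Unique (identity n)
identity-unique n = Unique.map⁺ suc-injective (Unique.upTo⁺ n)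

permutation-unique : ∀ {n x} → x ↭ identity n → Unique x
permutation-unique {n} p = Unique-resp-↭ (setoid ℕ) (↭⇒↭ₛ (↭-sym p)) (identity-unique n)

decode-injective : ∀ {c c′} → decode c ≡ decode c′ → c ≡ c′
decode-injective {c} {c′} = decodeR-injective ([] ∷ []) 1 c c′ [] []
  (permutation-unique (decodeR-↭ ([] ∷ []) 0 c ↭-refl))

-- Decoded permutations are sortable

-- A gap v | w is good if, once v has been read, a large entry can be pushed and
-- immediately popped again without ever creating an occurrence of 231.

record GoodGap (v w : Word) : Set where
  field
    rising : Increasing (stk v)
    below  : ∀ {s t} → s ∈ out v → t ∈ stk v ++ w → s ≤ t

Cuts : Word → Vec Word g → Set
Cuts w []       = ⊤
Cuts w (b ∷ bs) = GoodGap (flat bs) (b ++ w) × Cuts (b ++ w) bs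

feeds-head : ∀ {v} → All (_< m) v → feeds [] (m ∷ v) ≡ (out v , stk v ++ m ∷ [])
feeds-head {m} {v} v<m = feeds-bottom [] v v<m []

out-all : ∀ {P : ℕ → Set} v → All P v → All P (out v)
out-all v Pv = All.++⁻ˡ (out v) (All-resp-↭ (↭-sym (feeds-↭ [] v)) Pv)

stk-all : ∀ {P : ℕ → Set} v → All P v → All P (stk v)
stk-all v Pv = All.++⁻ʳ (out v) (All-resp-↭ (↭-sym (feeds-↭ [] v)) Pv)

increasing-∷ʳ : ∀ {st} → All (_≤ m) st → Increasing st → Increasing (st ++ m ∷ [])
increasing-∷ʳ []           inc τ = increasing-singleton τ
increasing-∷ʳ {m} {t ∷ st} (t≤m ∷ st≤m) inc = increasing-∷
  (λ p → [ (λ q → inc (refl ∷ from∈ q)) , (λ { (here refl) → t≤m }) ]′ (∈-++⁻ st p))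
  (increasing-∷ʳ st≤m (inc ∘ (_ ∷ʳ_)))

-- A larger `m` in front leaves the output unchanged and only adds a bottom entry to the stack;
-- entries to the right that are at least `m` exceed everything output so far.
goodGap-extend : ∀ {v w w′} → All (_< m) v → (∀ {t} → t ∈ w′ → t ∈ w ⊎ m ≤ t) → GoodGap v w → GoodGap (m ∷ v) w′
goodGap-extend {m} {v} {w} {w′} v<m w′⊆ gap = record
  { rising = subst (λ p → Increasing (proj₂ p)) (sym (feeds-head v<m))
      (increasing-∷ʳ (All.map <⇒≤ (stk-all v v<m)) rising)
  ; below = λ {s} {t} s∈ t∈ → below′ (subst (λ p → s ∈ proj₁ p) (feeds-head v<m) s∈)
      (subst (λ p → t ∈ proj₂ p ++ w′) (feeds-head v<m) t∈)
  }
  where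
  open GoodGap gap
  below′ : ∀ {s t} → s ∈ out v → t ∈ (stk v ++ m ∷ []) ++ w′ → s ≤ t
  below′ {s} {t} s∈ t∈ = cases (∈-++⁻ (stk v) (subst (t ∈_) (++-assoc (stk v) (m ∷ []) w′) t∈))
    where
    s<m = All.lookup (out-all v v<m) s∈
    cases : t ∈ stk v ⊎ t ∈ m ∷ w′ → s ≤ t
    cases (inj₁ p)           = below s∈ (∈-++⁺ˡ p)
    cases (inj₂ (here refl)) = <⇒≤ s<m
    cases (inj₂ (there p)) with w′⊆ p
    ... | inj₁ q   = below s∈ (∈-++⁺ʳ (stk v) q)
    ... | inj₂ m≤t = ≤-trans (<⇒≤ s<m) m≤t

-- The gap in front of `m` is trivially good, nothing having been read there; the others persist by
-- `goodGap-extend`.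
cuts-▷ : ∀ (bs : Vec Word g) {w w′} → All (_< m) (flat bs) → (∀ {t} → t ∈ w′ → t ∈ w ⊎ m ≤ t) →
  Cuts w bs → Cuts w′ (bs ▷ (m ∷ []))
cuts-▷ [] _ _ _ = record { rising = λ () ; below = λ () } , tt
cuts-▷ {m = m} (b ∷ bs) {w} {w′} bs<m w′⊆ (gap , cuts) =
  subst (λ v → GoodGap v (b ++ w′)) (sym (flat-▷ bs (m ∷ []))) (goodGap-extend (All.++⁻ˡ (flat bs) bs<m) bw′⊆ gap) ,
  cuts-▷ bs (All.++⁻ˡ (flat bs) bs<m) bw′⊆ cuts
  where
  bw′⊆ : ∀ {t} → t ∈ b ++ w′ → t ∈ b ++ w ⊎ m ≤ t
  bw′⊆ p with ∈-++⁻ b p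
  ... | inj₁ q = inj₁ (∈-++⁺ˡ q)
  ... | inj₂ q with w′⊆ q
  ...   | inj₁ r   = inj₁ (∈-++⁺ʳ b r)
  ...   | inj₂ m≤t = inj₂ m≤t

-- Mix m N p q y: the output y is q ∷ʳ m with decreasing entries between m and N inserted,
-- each one at a place where all smaller entries output before (including p) are below
-- those output after it.

data Mix (m : ℕ) : ℕ → Word → Word → Word → Set where
  done  : ∀ {N p} → Mix m N p [] (m ∷ [])
  small : ∀ {N p s q y} → s < m → Mix m N (p ++ s ∷ []) q y → Mix m N p (s ∷ q) (s ∷ y)
  large : ∀ {N p q l y} → m < l → l < N → (∀ {s t} → s ∈ p → t ∈ q → s ≤ t) →
    Mix m l p q y → Mix m N p q (l ∷ y)

mix-smalls : ∀ {p} r {q y} → All (_< m) r → Mix m N (p ++ r) q y → Mix m N p (r ++ q) (r ++ y)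
mix-smalls {p = p} [] _ mix = subst (λ p → Mix _ _ p _ _) (++-identityʳ p) mix
mix-smalls {p = p} (s ∷ r) (s<m ∷ r<m) mix =
  small s<m (mix-smalls r r<m (subst (λ p → Mix _ _ p _ _) (sym (++-assoc p (s ∷ []) r)) mix))

mix-∈ : ∀ {p q y t} → Mix m N p q y → t ∈ y → t ∈ q ⊎ m ≤ t
mix-∈ done            (here refl) = inj₂ ≤-refl
mix-∈ (small _ mix)   (here refl) = inj₁ (here refl)
mix-∈ (small _ mix)   (there p)   = [ inj₁ ∘ there , inj₂ ]′ (mix-∈ mix p)
mix-∈ (large m<l _ _ mix) (here refl) = inj₂ (<⇒≤ m<l)
mix-∈ (large _ _ _ mix)   (there p)   = mix-∈ mix p

mix-< : ∀ {p q y t} → m < N → Mix m N p q y → t ∈ y → t < N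
mix-< m<N done              (here refl) = m<N
mix-< m<N (small s<m mix)   (here refl) = <-trans s<m m<N
mix-< m<N (small _ mix)     (there p)   = mix-< m<N mix p
mix-< m<N (large _ l<N _ _) (here refl) = l<N
mix-< m<N (large m<l l<N _ mix) (there p) = <-trans (mix-< m<l mix p) l<N

-- If `s` in `p` is the 2 of a 231, then its 1 is a small entry of `q`. A small 3 gives a 231 in
-- `p ++ q`; a large 3 was inserted where no earlier small entry exceeds a later one.
mix-blocks231 : ∀ {p q y} → Mix m N p q y → Avoids231 (p ++ q) → All (_< m) p → Blocks231 p y
mix-blocks231 done av p<m s∈ (_ ∷ ())
mix-blocks231 done av p<m s∈ (_ ∷ʳ ())
mix-blocks231 {p = p} (small {s = s} {q} s<m mix) av p<m s∈ (_ ∷ʳ τ) =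
  mix-blocks231 mix (λ {_} → subst Avoids231 (sym (++-assoc p (s ∷ []) q)) (λ {_} → av))
    (All.++⁺ p<m (s<m ∷ [])) (∈-++⁺ˡ s∈) τ
mix-blocks231 (small _ mix) av p<m s∈ (refl ∷ τ) c<s s<b with mix-∈ mix (to∈ τ)
... | inj₁ c∈q = av (++⁺ (from∈ s∈) (refl ∷ from∈ c∈q)) c<s s<b
... | inj₂ m≤c = <⇒≱ (<-trans c<s (All.lookup p<m s∈)) m≤c
mix-blocks231 (large _ _ p≤q mix) av p<m s∈ (_ ∷ʳ τ) = mix-blocks231 mix av p<m s∈ τ
mix-blocks231 (large _ _ p≤q mix) av p<m s∈ (refl ∷ τ) c<s s<b with mix-∈ mix (to∈ τ)
... | inj₁ c∈q = <⇒≱ c<s (p≤q s∈ c∈q)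
... | inj₂ m≤c = <⇒≱ (<-trans c<s (All.lookup p<m s∈)) m≤c

-- A large entry cannot be the 2 of a 231, as everything output after it is smaller; small ones are
-- handled by `mix-blocks231`.
mix-avoids231 : ∀ {p q y} → Mix m N p q y → Avoids231 (p ++ q) → All (_< m) p → Avoids231 y
mix-avoids231 done av p<m (_ ∷ ())
mix-avoids231 done av p<m (_ ∷ʳ ())
mix-avoids231 {p = p} (small {s = s} {q} s<m mix) av p<m = λ
  { (_ ∷ʳ τ)   → mix-avoids231 mix (λ {_} → av′) p<m′ τ
  ; (refl ∷ τ) → mix-blocks231 mix (λ {_} → av′) p<m′ (∈-++⁺ʳ p (here refl)) τ }
  where
  av′ : Avoids231 ((p ++ s ∷ []) ++ q)
  av′ = subst Avoids231 (sym (++-assoc p (s ∷ []) q)) (λ {_} → av)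
  p<m′ = All.++⁺ p<m (s<m ∷ [])
mix-avoids231 (large _ _ _ mix)   av p<m (_ ∷ʳ τ) = mix-avoids231 mix av p<m τ
mix-avoids231 (large m<l _ _ mix) av p<m (refl ∷ τ) _ l<b = <-asym l<b (mix-< m<l mix (to∈ τ))

-- A large entry l is popped as soon as the next entry, being smaller than m, is read: it
-- would form the pattern 132 with l and m.

data StartsBelow (m : ℕ) : Word → Set where
  []  : StartsBelow m []
  _∷_ : ∀ {a} → a < m → ∀ z → StartsBelow m (a ∷ z)

-- Both patterns end in a descent, which would have to lie in `st`, whatever `l` is.
legal-increasing : ∀ {l st} → Increasing st → Legal (l ∷ st)
legal-increasing inc (_ ∷ʳ τ)   c<b _ = <⇒≱ c<b (inc (∷ˡ⁻ τ))
legal-increasing inc (refl ∷ τ) c<b _ = <⇒≱ c<b (inc τ)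

run-large : ∀ {l st z} → Increasing (st ++ m ∷ []) → m < l → StartsBelow m z →
  run (st ++ m ∷ []) (l ∷ z) ≡ l ∷ run (st ++ m ∷ []) z
run-large {m} {l} {st} {z} inc m<l z≺ = trans (run-push (st ++ m ∷ []) z (legal-increasing (λ {_} → inc))) (after z≺)
  where
  after : ∀ {z} → StartsBelow m z → run (l ∷ st ++ m ∷ []) z ≡ l ∷ run (st ++ m ∷ []) z
  after []        = refl
  after (a<m ∷ z) = run-pop (st ++ m ∷ []) z
    λ lg → lg (refl ∷ refl ∷ ++⁺ˡ st ⊆-refl) m<l (inj₁ a<m)

-- Tail bs m z N w: z is w with large entries m + 1, …, N − 1 inserted from right to left
-- into good gaps of flat bs ++ w.

record Tail (bs : Vec Word g) (m : ℕ) (z : Word) (N : ℕ) (w : Word) : Set where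
  field
    m<N    : m < N
    smalls : All (_< m) (flat bs ++ w)
    z<N    : All (_< N) z
    z⊆     : ∀ {t} → t ∈ z → t ∈ w ⊎ m ≤ t
    cuts   : Cuts w bs
    avoids : Avoids231 (sort (flat bs ++ w))
    mix    : Mix m N (out (flat bs)) (run (stk (flat bs)) w) (run (stk (flat bs) ++ m ∷ []) z)

  bs<m : All (_< m) (flat bs)
  bs<m = All.++⁻ˡ (flat bs) smalls

-- The entries of `flat bs` are all small, so what is output while they are read extends `mix` back
-- to the start of the word.
tail-avoids231 : ∀ {bs : Vec Word g} {z w} → Tail bs m z N w → Avoids231 (sort (m ∷ flat bs ++ z))
tail-avoids231 {m = m} {N} {bs} {z} {w} tail = subst Avoids231
  (sym (trans (run-feeds (m ∷ []) v z) (cong (λ (p , st) → p ++ run st z) (feeds-head bs<m))))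
  (mix-avoids231 (mix-smalls {p = []} (out v) (out-all v bs<m) mix)
    (λ {_} → subst Avoids231 (run-feeds [] v w) (λ {_} → avoids)) [])
  where
  open Tail tail
  v = flat bs

tail-fall : ∀ {bs : Vec Word g} {b z w} → Tail (b ∷ bs) m z N w → Tail bs m (b ++ z) N (b ++ w)
tail-fall {m = m} {N} {bs} {b} {z} {w} tail = record
  { m<N    = m<N
  ; smalls = subst (All (_< m)) (++-assoc v b w) smalls
  ; z<N    = All.++⁺ (All.map (λ a<m → <-trans a<m m<N) b<m) z<N
  ; z⊆     = λ t∈ → [ inj₁ ∘ ∈-++⁺ˡ , (λ t∈z → [ inj₁ ∘ ∈-++⁺ʳ b , inj₂ ]′ (z⊆ t∈z)) ]′ (∈-++⁻ b t∈)
  ; cuts   = proj₂ cuts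
  ; avoids = subst (λ x → Avoids231 (sort x)) (++-assoc v b w) (λ {_} → avoids)
  ; mix    = subst₂ (Mix m N (out v)) (sym (run-feeds (stk v) b w))
      (sym (trans (run-feeds (stk v ++ m ∷ []) b z)
        (cong (λ (p , st) → p ++ run st z) (feeds-bottom (stk v) b b<m stk<m))))
      (mix-smalls (proj₁ (feeds (stk v) b))
        (All.++⁻ˡ _ (All-resp-↭ (↭-sym (feeds-↭ (stk v) b)) (All.++⁺ stk<m b<m)))
        (subst (λ (o , st) → Mix m N o (run st w) (run (st ++ m ∷ []) z)) (feeds-++ [] v b) mix))
  }
  where
  open Tail tail
  v = flat bs
  b<m = All.++⁻ʳ v bs<m
  stk<m = stk-all v (All.++⁻ˡ v bs<m)

-- By `rising`, the entry `N` can be pushed at once, and it is popped next because `z` is empty or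
-- starts with a small entry; `below` is the condition of `large`.
tail-insert : ∀ {bs : Vec Word g} {z w} → GoodGap (flat bs) w → StartsBelow m z →
  Tail bs m z N w → Tail bs m (N ∷ z) (suc N) w
tail-insert {m = m} {N} {bs} {z} {w} gap z≺ tail = record
  { m<N    = m<n⇒m<1+n m<N
  ; smalls = smalls
  ; z<N    = n<1+n N ∷ <-all-suc z<N
  ; z⊆     = λ { (here refl) → inj₂ (<⇒≤ m<N) ; (there t∈) → z⊆ t∈ }
  ; cuts   = cuts
  ; avoids = avoids
  ; mix    = subst (Mix m (suc N) (out v) (run (stk v) w))
      (sym (run-large {st = stk v} (increasing-∷ʳ (All.map <⇒≤ (stk-all v bs<m)) rising) m<N z≺))
      (large m<N (n<1+n N) (λ s∈ t∈ → below s∈ (∈-resp-↭ (process-↭ patterns (stk v) w) t∈)) mix)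
  }
  where
  open Tail tail
  open GoodGap gap
  v = flat bs

tail-start : ∀ (bs : Vec Word g) → All (_< N) (flat bs) → Cuts [] bs → Avoids231 (sort (flat bs)) →
  Tail bs N [] (suc N) []
tail-start {N = N} bs bs<N cuts av = record
  { m<N    = n<1+n N
  ; smalls = All.++⁺ bs<N []
  ; z<N    = []
  ; z⊆     = λ ()
  ; cuts   = cuts
  ; avoids = subst (λ x → Avoids231 (sort x)) (sym (++-identityʳ (flat bs))) (λ {_} → av)
  ; mix    = subst (λ q → Mix N (suc N) (out (flat bs)) q (stk (flat bs) ++ N ∷ [])) (++-identityʳ _)
      (mix-smalls (stk (flat bs)) (stk-all (flat bs) bs<N) done)
  }

-- An entry inserted in front of an empty block is followed directly by `z`; an empty `z` excludes
-- two adjacent large entries.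
HeadEmptyAtEnd : Vec Word g → Word → Set
HeadEmptyAtEnd []       z = ⊤
HeadEmptyAtEnd (b ∷ bs) z = b ≡ [] → z ≡ []

head-nonempty : ∀ {bs : Vec Word g} {z} → VAll.All (_≢ []) bs → HeadEmptyAtEnd bs z
head-nonempty []       = tt
head-nonempty (b≢ ∷ _) = λ b≡ → contradiction b≡ b≢

startsBelow : ∀ b {z} → (b ≡ [] → z ≡ []) → All (_< m) b → StartsBelow m (b ++ z)
startsBelow []      h _         rewrite h refl = []
startsBelow (a ∷ b) h (a<m ∷ _) = a<m ∷ (b ++ _)

tail-bump : ∀ {bs : Vec Word g} {b m z N w} → HeadEmptyAtEnd (b ∷ bs) z → Tail (b ∷ bs) m z N w →
  Tail bs m (N ∷ b ++ z) (suc N) (b ++ w)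
tail-bump {bs = bs} {b} h tail =
  tail-insert (proj₁ (Tail.cuts tail)) (startsBelow b h (All.++⁻ʳ (flat bs) (Tail.bs<m tail))) (tail-fall tail)

mutual
  decodeR-avoids231 : ∀ (bs : Vec Word g) N c → Proper bs → All (_< N) (flat bs) → Cuts [] bs →
    Avoids231 (sort (flat bs)) → Avoids231 (sort (decodeR bs N c))
  decodeR-avoids231 bs N (up c) bs≢ bs<N cuts av = decodeR-avoids231 (bs ▷ (N ∷ [])) (suc N) c (proper-▷ bs bs≢)
    (subst (All (_< suc N)) (sym (flat-▷ bs (N ∷ []))) (n<1+n N ∷ <-all-suc bs<N))
    (cuts-▷ bs bs<N (λ ()) cuts)
    (subst (λ x → Avoids231 (sort x)) (trans (cong (N ∷_) (++-identityʳ _)) (sym (flat-▷ bs (N ∷ []))))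
      (tail-avoids231 (tail-start bs bs<N cuts (λ {_} → av))))
  decodeR-avoids231 bs N (turn c) bs≢ bs<N cuts av =
    decodeF-avoids231 bs N [] (suc N) [] c bs≢ (empty bs) (tail-start bs bs<N cuts (λ {_} → av))
    where
    empty : ∀ {g} (bs : Vec Word g) → HeadEmptyAtEnd bs []
    empty []       = tt
    empty (_ ∷ bs) = λ _ → refl

  decodeF-avoids231 : ∀ (bs : Vec Word g) m z N w c → Proper bs → HeadEmptyAtEnd bs z → Tail bs m z N w →
    Avoids231 (sort (decodeF bs m z N c))
  decodeF-avoids231 [] m z N w stop _ _ tail = tail-avoids231 tail
  decodeF-avoids231 (b ∷ bs) m z N w (fall c) bs≢ h tail =
    decodeF-avoids231 bs m (b ++ z) N (b ++ w) c (proper-tail bs≢) (head-nonempty bs≢) (tail-fall tail)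
  decodeF-avoids231 (b ∷ bs) m z N w (bump c) bs≢ h tail =
    decodeF-avoids231 bs m (N ∷ b ++ z) (suc N) (b ++ w) c (proper-tail bs≢) (head-nonempty bs≢)
      (tail-bump h tail)
  decodeF-avoids231 (b ∷ bs) m z N w (climb c) bs≢ h tail =
    decodeR-avoids231 ((N ∷ b ++ z) ∷ (bs ▷ (m ∷ []))) (suc N) c (all-▷ bs≢)
      (subst (All (_< suc N)) (sym (flat-climb bs m (N ∷ b ++ z)))
        (m<N ∷ All.++⁺ (All.map (λ a<m → <-trans a<m m<N) bs<m) z<N))
      -- The gap in front of the leftmost large entry stays good: what follows it lies in `b ++ w`
      -- or is at least `m`.
      (subst₂ GoodGap (sym (flat-▷ bs (m ∷ []))) (sym (++-identityʳ _))
        (goodGap-extend bs<m z⊆ (proj₁ (Tail.cuts tail))) ,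
       subst (λ x → Cuts x (bs ▷ (m ∷ []))) (sym (++-identityʳ _)) (cuts-▷ bs bs<m z⊆ cuts))
      (subst (λ x → Avoids231 (sort x)) (sym (flat-climb bs m (N ∷ b ++ z))) (tail-avoids231 tail′))
    where
    tail′ = tail-bump h tail
    open Tail tail′ using (m<N; bs<m; z<N; z⊆; cuts)

decode-avoids231 : ∀ c → Avoids231 (sort (decode c))
decode-avoids231 c = decodeR-avoids231 ([] ∷ []) 1 c [] []
  (record { rising = λ () ; below = λ () } , tt) (λ ())

-- Necessary conditions for sortability

smalls : ℕ → Word → Word
smalls m = filter (_<? m)

smalls-< : ∀ {a x} → a < m → smalls m (a ∷ x) ≡ a ∷ smalls m x
smalls-< {m} = filter-accept (_<? m)

smalls-> : ∀ {a x} → m < a → smalls m (a ∷ x) ≡ smalls m x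
smalls-> {m} m<a = filter-reject (_<? m) (<-asym m<a)

avoids231-⊆ : ∀ {x y} → x ⊆ y → Avoids231 y → Avoids231 x
avoids231-⊆ σ av τ = av (⊆-trans τ σ)

-- Two entries cannot contain a pattern of length three, so the bottom entry is never popped while
-- input remains.
feed-last : ∀ m st a → ∃ λ st′ → proj₂ (feed (st ++ m ∷ []) a) ≡ st′ ++ m ∷ []
feed-last m [] a with legal? (a ∷ m ∷ [])
... | yes _  = a ∷ [] , refl
... | no ¬lg = ⊥-elim (¬lg λ { (_ ∷ _ ∷ ()) ; (_ ∷ _ ∷ʳ ()) ; (_ ∷ʳ _ ∷ ()) ; (_ ∷ʳ _ ∷ʳ ()) })
feed-last m (t ∷ st) a with legal? (a ∷ t ∷ st ++ m ∷ [])
... | yes _ = a ∷ t ∷ st , refl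
... | no  _ = feed-last m st a

feeds-last : ∀ m st v → ∃ λ st′ → proj₂ (feeds (st ++ m ∷ []) v) ≡ st′ ++ m ∷ []
feeds-last m st []      = st , refl
feeds-last m st (a ∷ v) with st₁ , eq ← feed-last m st a with st₂ , eq₂ ← feeds-last m st₁ v =
  st₂ , trans (cong (λ s → proj₂ (feeds s v)) eq) eq₂

run-last : ∀ m st v {t} → t ≢ m → t ∈ v → t ∷ m ∷ [] ⊆ run (st ++ m ∷ []) v
run-last m st v {t} t≢m t∈ = subst (t ∷ m ∷ [] ⊆_) (sym eq) (++⁺ (from∈ t∈init) (refl ∷ []))
  where
  o = proj₁ (feeds (st ++ m ∷ []) v)
  last = feeds-last m st v
  init = o ++ proj₁ last
  eq : run (st ++ m ∷ []) v ≡ init ++ m ∷ []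
  eq = trans (cong (run (st ++ m ∷ [])) (sym (++-identityʳ v)))
    (trans (run-feeds (st ++ m ∷ []) v []) (trans (cong (o ++_) (proj₂ last)) (sym (++-assoc o _ _))))
  t∈init : t ∈ init
  t∈init with ∈-++⁻ init (subst (t ∈_) eq (∈-process patterns (st ++ m ∷ []) v (∈-++⁺ʳ (st ++ m ∷ []) t∈)))
  ... | inj₁ p           = p
  ... | inj₂ (here refl) = contradiction refl t≢m

-- If `l` is pushed at once, a descent on the stack would form 321 with it. If `t` is popped first,
-- any smaller `s` below it is output after `l`, which gives the 231 `t l s`.
rising-before-large : ∀ {l} st xs → All (_< m) st → m < l → Avoids231 (run (st ++ m ∷ []) (l ∷ xs)) → Increasing st
rising-before-large [] xs _ _ _ = λ ()
rising-before-large {m} {l} (t ∷ st) xs (t<m ∷ st<m) m<l av with legal? (l ∷ t ∷ st ++ m ∷ [])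
... | yes lg = λ τ → ≮⇒≥ λ b<a → lg (refl ∷ ++⁺ʳ (m ∷ []) τ) b<a
    (inj₂ (<-trans (All.lookup (t<m ∷ st<m) (to∈ τ)) m<l))
... | no ¬lg = increasing-∷ (λ s∈ → ≮⇒≥ λ s<t → av′ (refl ∷ l∷s⊆ s∈) s<t (<-trans t<m m<l)) inc
  where
  av′ : Avoids231 (t ∷ run (st ++ m ∷ []) (l ∷ xs))
  av′ = subst Avoids231 (run-pop (st ++ m ∷ []) xs ¬lg) (λ {_} → av)
  inc : Increasing st
  inc = rising-before-large st xs st<m m<l (avoids231-⊆ (t ∷ʳ ⊆-refl) (λ {_} → av′))
  l∷s⊆ : ∀ {s} → s ∈ st → l ∷ s ∷ [] ⊆ run (st ++ m ∷ []) (l ∷ xs)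
  l∷s⊆ {s} s∈ = subst (l ∷ s ∷ [] ⊆_)
    (sym (run-push (st ++ m ∷ []) xs
      (legal-increasing (increasing-∷ʳ (All.map <⇒≤ st<m) (λ {_} → inc)))))
    (⊆-trans (refl ∷ ++⁺ʳ (m ∷ []) (from∈ s∈)) (stack⊆process patterns (l ∷ st ++ m ∷ []) xs))

-- Suppose a large `a` comes next. If `a < l`, it is pushed onto `l`, and `a l m` is output in this
-- order; otherwise `l` is popped first, and the order is `l a m`. Both are 231.
below-after-large : ∀ {l st xs} → Increasing (st ++ m ∷ []) → All (_≤ m) (st ++ m ∷ []) → m < l →
  All (_≢ m) xs → l ∉ xs → Avoids231 (run (l ∷ st ++ m ∷ []) xs) → StartsBelow m xs
below-after-large {xs = []} _ _ _ _ _ _ = []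
below-after-large {m} {l} {st} {a ∷ xs} inc s≤m m<l (a≢m ∷ _) l∉ av with <-cmp a m
... | tri< a<m _ _ = a<m ∷ xs
... | tri≈ _ a≡m _ = contradiction a≡m a≢m
... | tri> _ _ m<a with <-cmp a l
...   | tri≈ _ refl _ = contradiction (here refl) l∉
...   | tri< a<l _ _ = ⊥-elim (av
          (subst (a ∷ l ∷ m ∷ [] ⊆_) (sym (run-push (l ∷ st ++ m ∷ []) xs legal))
            (⊆-trans (refl ∷ refl ∷ ++⁺ˡ st ⊆-refl) (stack⊆process patterns (a ∷ l ∷ st ++ m ∷ []) xs)))
          m<a a<l)
  where
  legal : Legal (a ∷ l ∷ st ++ m ∷ [])
  legal (_ ∷ʳ τ)          = legal-increasing (λ {_} → inc) τ
  legal (refl ∷ (_ ∷ʳ τ)) c<b _ = <⇒≱ c<b (inc τ)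
  legal (refl ∷ (refl ∷ τ)) _ (inj₁ a<c) = <⇒≱ (<-trans m<a a<c) (All.lookup s≤m (to∈ τ))
  legal (refl ∷ (refl ∷ τ)) _ (inj₂ l<a) = <-asym l<a a<l
...   | tri> _ _ l<a = ⊥-elim (av
          (subst (l ∷ a ∷ m ∷ [] ⊆_)
            (sym (trans (run-pop (st ++ m ∷ []) xs λ lg → lg (refl ∷ refl ∷ ++⁺ˡ st ⊆-refl) m<l (inj₂ l<a))
              (cong (l ∷_) (run-push (st ++ m ∷ []) xs (legal-increasing (λ {_} → inc))))))
            (refl ∷ ⊆-trans (refl ∷ ++⁺ˡ st ⊆-refl) (stack⊆process patterns (a ∷ st ++ m ∷ []) xs)))
          m<l l<a)

-- The gap is one of the word of small entries alone, of which `v` has been read before `α`.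
record Allowed (m : ℕ) (v α : Word) (l : ℕ) (β : Word) : Set where
  field
    gap        : GoodGap (v ++ smalls m α) (smalls m β)
    next       : StartsBelow m β
    decreasing : ∀ {t} → t ∈ β → t ≤ l

AllAllowed : ℕ → Word → Word → Set
AllAllowed m v xs = ∀ α l β → xs ≡ α ++ l ∷ β → m < l → Allowed m v α l β

-- Induction on the unread input `xs`, where `v` holds the small entries already read and `y` the
-- output so far. Each large entry is popped right after its push, so the stack is always
-- `stk v ++ m ∷ []`.
necessary : ∀ v xs y → out v ⊆ y → All (_< m) v → All (_≢ m) xs → Unique xs →
  Avoids231 (y ++ run (stk v ++ m ∷ []) xs) → Avoids231 (sort (v ++ smalls m xs)) × AllAllowed m v xs
necessary {m} v [] y o⊆y _ _ _ av =
  (λ {_} → subst Avoids231 (trans (sym (sort-feeds v)) (cong sort (sym (++-identityʳ v))))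
    (avoids231-⊆ (++⁺ o⊆y (++⁺ʳ (m ∷ []) ⊆-refl)) (λ {_} → av))) ,
  λ { [] _ _ () ; (_ ∷ _) _ _ () }
necessary {m} v (a ∷ xs) y o⊆y v<m (a≢m ∷ xs≢m) (a∉ ∷ uq) av with <-cmp a m
... | tri≈ _ a≡m _ = contradiction a≡m a≢m
... | tri< a<m _ _ = (λ {_} → subst (λ w → Avoids231 (sort w)) small-eq (λ {_} → proj₁ ih)) , allowed
  where
  p = proj₁ (feeds (stk v) (a ∷ []))
  st = proj₂ (feeds (stk v) (a ∷ []))
  eqs : feeds [] (v ++ a ∷ []) ≡ (out v ++ p , st)
  eqs = feeds-++ [] v (a ∷ [])
  run-eq : run (stk v ++ m ∷ []) (a ∷ xs) ≡ p ++ run (st ++ m ∷ []) xs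
  run-eq = trans (run-feeds (stk v ++ m ∷ []) (a ∷ []) xs)
    (cong (λ (p , st) → p ++ run st xs) (feeds-bottom (stk v) (a ∷ []) (a<m ∷ []) (stk-all v v<m)))
  small-eq : (v ++ a ∷ []) ++ smalls m xs ≡ v ++ smalls m (a ∷ xs)
  small-eq = trans (++-assoc v (a ∷ []) _) (cong (v ++_) (sym (smalls-< a<m)))
  ih = necessary (v ++ a ∷ []) xs (y ++ p)
    (subst (_⊆ y ++ p) (sym (cong proj₁ eqs)) (++⁺ o⊆y ⊆-refl))
    (All.++⁺ v<m (a<m ∷ [])) xs≢m uq
    (subst Avoids231 (trans (cong (y ++_) run-eq)
      (trans (sym (++-assoc y p _)) (cong (λ s → (y ++ p) ++ run (s ++ m ∷ []) xs) (sym (cong proj₂ eqs)))))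
      (λ {_} → av))
  allowed : AllAllowed m v (a ∷ xs)
  allowed [] l β refl m<l = contradiction a<m (<-asym m<l)
  allowed (a ∷ α) l β refl m<l = record
    { gap = subst (λ w → GoodGap w (smalls m β))
        (trans (++-assoc v (a ∷ []) _) (cong (v ++_) (sym (smalls-< a<m)))) gap
    ; next = next ; decreasing = decreasing }
    where open Allowed (proj₂ ih α l β refl m<l)
... | tri> _ _ m<a =
  (λ {_} → subst (λ w → Avoids231 (sort (v ++ w))) (sym (smalls-> m<a)) (λ {_} → proj₁ ih)) , allowed
  where
  rising : Increasing (stk v)
  rising = rising-before-large (stk v) xs (stk-all v v<m) m<a (avoids231-⊆ (++⁺ˡ y ⊆-refl) (λ {_} → av))
  rising′ : Increasing (stk v ++ m ∷ [])
  rising′ = increasing-∷ʳ (All.map <⇒≤ (stk-all v v<m)) (λ {_} → rising)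
  a≺xs : StartsBelow m xs
  a≺xs = below-after-large {st = stk v} (λ {_} → rising′)
    (All.++⁺ (All.map <⇒≤ (stk-all v v<m)) (≤-refl ∷ [])) m<a xs≢m
    (λ p → All.lookup a∉ p refl)
    (subst Avoids231 (run-push (stk v ++ m ∷ []) xs (legal-increasing (λ {_} → rising′)))
      (avoids231-⊆ (++⁺ˡ y ⊆-refl) (λ {_} → av)))
  av′ : Avoids231 (y ++ a ∷ run (stk v ++ m ∷ []) xs)
  av′ = subst (λ w → Avoids231 (y ++ w)) (run-large {st = stk v} (λ {_} → rising′) m<a a≺xs) (λ {_} → av)
  ih = necessary v xs (y ++ a ∷ []) (++⁺ʳ (a ∷ []) o⊆y) v<m xs≢m uq
    (subst Avoids231 (sym (++-assoc y (a ∷ []) _)) (λ {_} → av′))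
  below : ∀ {s t} → s ∈ out v → t ∈ stk v ++ smalls m xs → s ≤ t
  -- Otherwise `s`, which is output already, the large entry `a` and the later `t` form a 231.
  below {s} {t} s∈ t∈ = ≮⇒≥ λ t<s → av′
    (++⁺ (⊆-trans (from∈ s∈) o⊆y) (refl ∷ from∈ (∈-process patterns (stk v ++ m ∷ []) xs (t∈′ (∈-++⁻ (stk v) t∈)))))
    t<s (<-trans (All.lookup (out-all v v<m) s∈) m<a)
    where
    t∈′ : t ∈ stk v ⊎ t ∈ smalls m xs → t ∈ (stk v ++ m ∷ []) ++ xs
    t∈′ (inj₁ q) = ∈-++⁺ˡ (∈-++⁺ˡ q)
    t∈′ (inj₂ q) = ∈-++⁺ʳ (stk v ++ m ∷ []) (proj₁ (∈-filter⁻ (_<? m) q))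
  allowed : AllAllowed m v (a ∷ xs)
  allowed [] l β refl m<l = record
    { gap = subst (λ w → GoodGap w (smalls m β)) (sym (++-identityʳ v))
        (record { rising = λ {_} → rising ; below = below })
    ; next = a≺xs
    -- A larger `t` to come would give the 231 `a t m`, as `m` is output last.
    ; decreasing = λ {t} t∈ → ≮⇒≥ λ a<t → av′
        (++⁺ˡ y (refl ∷ run-last m (stk v) xs (All.lookup xs≢m t∈) t∈)) m<a a<t
    }
  allowed (a ∷ α) l β refl m<l = record
    { gap = subst (λ w → GoodGap (v ++ w) (smalls m β)) (sym (smalls-> m<a)) gap
    ; next = next ; decreasing = decreasing }
    where open Allowed (proj₂ ih α l β refl m<l)

-- Maximality of the list of good gaps

goodGap-restrict : ∀ {v w w′} → All (_< m) v → (∀ {t} → t ∈ w → t ∈ w′) → GoodGap (m ∷ v) w′ → GoodGap v w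
goodGap-restrict {m} {v} {w} {w′} v<m w⊆ gap = record
  { rising = λ τ → rising (subst (λ p → _ ⊆ proj₂ p) (sym (feeds-head v<m)) (++⁺ʳ (m ∷ []) τ))
  ; below  = λ {s} s∈ t∈ → below (subst (λ p → s ∈ proj₁ p) (sym (feeds-head v<m)) s∈)
      (subst (λ p → _ ∈ proj₂ p ++ w′) (sym (feeds-head v<m)) (lift (∈-++⁻ (stk v) t∈)))
  }
  where
  open GoodGap gap
  lift : ∀ {t} → t ∈ stk v ⊎ t ∈ w → t ∈ (stk v ++ m ∷ []) ++ w′
  lift (inj₁ p) = ∈-++⁺ˡ (∈-++⁺ˡ p)
  lift (inj₂ p) = ∈-++⁺ʳ (stk v ++ m ∷ []) (w⊆ p)

-- Either `l` has been output although the smaller `m` is still on the stack, against `below`, or it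
-- lies on the stack above `m`, against `rising`.
¬goodGap-large : ∀ {v w l} → m < l → l ∈ v → ¬ GoodGap (m ∷ v) w
¬goodGap-large {m} {v} {w} {l} m<l l∈ gap =
  cases (∈-++⁻ (out (m ∷ v)) (∈-resp-↭ (↭-sym (feeds-↭ [] (m ∷ v))) (there l∈)))
  where
  open GoodGap gap
  last = feeds-last m [] v
  cases : l ∈ out (m ∷ v) ⊎ l ∈ stk (m ∷ v) → ⊥
  cases (inj₁ p) = <⇒≱ m<l (below p (∈-++⁺ˡ (subst (m ∈_) (sym (proj₂ last)) (∈-++⁺ʳ (proj₁ last) (here refl)))))
  cases (inj₂ p) with ∈-++⁻ (proj₁ last) (subst (l ∈_) (proj₂ last) p)
  ... | inj₁ q = <⇒≱ m<l (rising (subst (l ∷ m ∷ [] ⊆_) (sym (proj₂ last)) (++⁺ (from∈ q) (refl ∷ []))))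
  ... | inj₂ (here refl) = <-irrefl refl m<l

-- This concerns gaps strictly inside a block, with `w` to the right of all blocks; the right end of
-- the word is treated in `Maximal`.
Uncut : Word → Vec Word g → Set
Uncut w []       = ⊤
Uncut w (b ∷ bs) =
  (∀ b₁ b₂ → b ≡ b₁ ++ b₂ → b₁ ≢ [] → b₂ ≢ [] → ¬ GoodGap (flat bs ++ b₁) (b₂ ++ w)) × Uncut (b ++ w) bs

-- Every good gap of flat bs is the front of some block.
Maximal : Vec Word (suc g) → Set
Maximal (b ∷ bs) = (b ≢ [] → ¬ GoodGap (flat bs ++ b) []) × Uncut [] (b ∷ bs)

uncut-▷ : ∀ (bs : Vec Word g) {w w′} → All (_< m) (flat bs) → (∀ {t} → t ∈ w → t ∈ w′) →
  Uncut w bs → Uncut w′ (bs ▷ (m ∷ []))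
uncut-▷ [] _ _ _ = noSplit , tt
  where
  noSplit : ∀ {m w′} b₁ b₂ → m ∷ [] ≡ b₁ ++ b₂ → b₁ ≢ [] → b₂ ≢ [] → ¬ GoodGap b₁ (b₂ ++ w′)
  noSplit []       b₂ eq b₁≢ b₂≢ _ = b₁≢ refl
  noSplit (_ ∷ b₁) b₂ eq b₁≢ b₂≢ _ = b₂≢ (++-conicalʳ b₁ b₂ (sym (∷-injectiveʳ eq)))
uncut-▷ {m = m} (b ∷ bs) {w} {w′} bs<m w⊆ (un , uns) =
  (λ b₁ b₂ eq b₁≢ b₂≢ gap → un b₁ b₂ eq b₁≢ b₂≢
    (goodGap-restrict
      (All.++⁺ (All.++⁻ˡ (flat bs) bs<m) (All.++⁻ˡ b₁ (subst (All (_< m)) eq (All.++⁻ʳ (flat bs) bs<m))))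
      (λ t∈ → [ ∈-++⁺ˡ , ∈-++⁺ʳ b₂ ∘ w⊆ ]′ (∈-++⁻ b₂ t∈))
      (subst (λ v → GoodGap (v ++ b₁) (b₂ ++ w′)) (flat-▷ bs (m ∷ [])) gap))) ,
  uncut-▷ bs (All.++⁻ˡ (flat bs) bs<m) (λ t∈ → [ ∈-++⁺ˡ , ∈-++⁺ʳ b ∘ w⊆ ]′ (∈-++⁻ b t∈)) uns

maximal-▷ : ∀ (bs : Vec Word (suc g)) → All (_< m) (flat bs) → Maximal bs → Maximal (bs ▷ (m ∷ []))
maximal-▷ {m = m} (b ∷ bs) bs<m (top , un) =
  (λ b≢ gap → top b≢ (goodGap-restrict bs<m (λ ()) (subst (λ v → GoodGap (v ++ b) []) (flat-▷ bs (m ∷ [])) gap))) ,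
  uncut-▷ (b ∷ bs) bs<m (λ ()) un

-- Every gap inside or at the end of the head block has the large entry `l` to its left.
maximal-climb : ∀ (bs : Vec Word g) {w z l} → All (_< m) (flat bs) → (∀ {t} → t ∈ w → t ∈ z) → m < l →
  Uncut w bs → Maximal ((l ∷ z) ∷ (bs ▷ (m ∷ [])))
maximal-climb {m = m} bs {w} {z} {l} bs<m w⊆ m<l un =
  (λ _ → noGap z) ,
  (λ { [] b₂ eq b₁≢ _ → contradiction refl b₁≢
     ; (_ ∷ b₁) b₂ refl _ _ → noGap b₁ }) ,
  uncut-▷ bs bs<m (λ t∈ → ∈-++⁺ˡ (there (w⊆ t∈))) un
  where
  noGap : ∀ b₁ {w} → ¬ GoodGap (flat (bs ▷ (m ∷ [])) ++ l ∷ b₁) w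
  noGap b₁ gap = ¬goodGap-large m<l (∈-++⁺ʳ (flat bs) (here refl))
    (subst (λ v → GoodGap (v ++ l ∷ b₁) _) (flat-▷ bs (m ∷ [])) gap)

-- Surjectivity of decoding

-- A prefix of a code leading to a given state is represented by its action on suffixes.

ReachR : Vec Word g → ℕ → Set
ReachR bs N = ∀ c → ∃ λ c₀ → decode c₀ ≡ decodeR bs N c

ReachF : Vec Word g → ℕ → Word → ℕ → Set
ReachF bs m z N = ∀ c → ∃ λ c₀ → decode c₀ ≡ decodeF bs m z N c

record Reached (x : Word) (N : ℕ) : Set where
  constructor reached
  field
    {len}   : ℕ
    blocks  : Vec Word (suc len)
    flat≡   : flat blocks ≡ x
    reach   : ReachR blocks N
    maximal : Maximal blocks

∈-identity⁻ : ∀ {n t} → t ∈ identity n → 1 ≤ t × t ≤ n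
∈-identity⁻ p with _ , q , refl ← ∈-map⁻ suc p = s≤s z≤n , ∈-upTo⁻ q

∈-identity⁺ : ∀ {n t} → 1 ≤ t → t ≤ n → t ∈ identity n
∈-identity⁺ (s≤s z≤n) t≤n = ∈-map⁺ suc (∈-upTo⁺ t≤n)

length-permutation : ∀ {n x} → x ↭ identity n → length x ≡ n
length-permutation {n} p = trans (↭-length p) (trans (length-map suc (upTo n)) (length-upTo n))

split-smalls : ∀ α v {b} → smalls m α ≡ v ++ b →
  ∃₂ λ α₁ β → α ≡ α₁ ++ β × smalls m α₁ ≡ v × smalls m β ≡ b × StartsBelow m β
split-smalls []      []      eq = [] , [] , refl , refl , eq , []
split-smalls {m} (c ∷ α) v eq with c <? m
split-smalls {m} (c ∷ α) [] eq | yes c<m = [] , c ∷ α , refl , refl , eq , c<m ∷ α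
split-smalls {m} (c ∷ α) (a ∷ v) eq | yes c<m with refl , eq′ ← ∷-injective (trans (sym (smalls-< c<m)) eq)
  with α₁ , β , refl , eq₁ , eq₂ , β≺ ← split-smalls α v eq′ =
  c ∷ α₁ , β , refl , trans (smalls-< c<m) (cong (c ∷_) eq₁) , eq₂ , β≺
split-smalls {m} (c ∷ α) v eq | no c≮m
  with α₁ , β , refl , eq₁ , eq₂ , β≺ ← split-smalls α v (trans (sym (filter-reject (_<? m) c≮m)) eq) =
  c ∷ α₁ , β , refl , trans (filter-reject (_<? m) c≮m) eq₁ , eq₂ , β≺

EndsBelow : ℕ → Word → Set
EndsBelow m α = ∀ α′ l → α ≡ α′ ++ l ∷ [] → l < m

last-large : ∀ a x → smalls m (a ∷ x) ≡ [] → ∃₂ λ x′ e → a ∷ x ≡ x′ ++ e ∷ [] × ¬ e < m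
last-large {m} a x eq with a <? m
last-large {m} a x eq | yes a<m with () ← trans (sym (smalls-< a<m)) eq
last-large {m} a [] eq | no a≮m = [] , a , refl , a≮m
last-large {m} a (a′ ∷ x) eq | no a≮m
  with x′ , e , eq′ , e≮m ← last-large a′ x (trans (sym (filter-reject (_<? m) a≮m)) eq) =
  a ∷ x′ , e , cong (a ∷_) eq′ , e≮m

-- The gap at the end of the unread part `α` has been dealt with, unless the next block is empty and
-- its own gap lies there.
EndOK : ℕ → Vec Word g → Word → Set
EndOK m []       α = EndsBelow m α
EndOK m (b ∷ bs) α = b ≢ [] → EndsBelow m α

endOK : ∀ (bs : Vec Word g) {α} → EndsBelow m α → EndOK m bs α
endOK []       e = e
endOK (b ∷ bs) e = λ _ → e

unique-++⁻ʳ : ∀ (xs : Word) {ys} → Unique (xs ++ ys) → Unique ys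
unique-++⁻ʳ []       uq       = uq
unique-++⁻ʳ (x ∷ xs) (_ ∷ uq) = unique-++⁻ʳ xs uq

module _ {m n : ℕ} {xs : Word} (x↭ : m ∷ xs ↭ identity n) (allowed : AllAllowed m [] xs) where

  xs-unique : Unique xs
  xs-unique with _ ∷ uq ← permutation-unique x↭ = uq

  m∉xs : All (m ≢_) xs
  m∉xs with m∉ ∷ _ ← permutation-unique x↭ = m∉

  -- As `β` starts with a small entry, a large one in it would lie in a good gap strictly inside the
  -- block, against `Uncut`, or at the end of the block, against the last hypothesis.
  block-small : ∀ (bs : Vec Word g) {b} α₁ β z → xs ≡ (α₁ ++ β) ++ z → smalls m α₁ ≡ flat bs → smalls m β ≡ b →
    StartsBelow m β → Uncut (smalls m z) (b ∷ bs) → (b ≢ [] → EndsBelow m (α₁ ++ β)) → All (_< m) β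
  block-small bs {b} α₁ β z xs≡ α₁≡ β≡ β≺ (un , _) ends = All.tabulate below
    where
    below : ∀ {t} → t ∈ β → t < m
    below {t} t∈ with <-cmp t m
    ... | tri< t<m _ _ = t<m
    ... | tri≈ _ refl _ =
      contradiction refl (All.lookup m∉xs (subst (t ∈_) (sym xs≡) (∈-++⁺ˡ (∈-++⁺ʳ α₁ t∈))))
    ... | tri> _ _ m<t with β₁ , β₂ , eq ← ∈-∃++ t∈ = ⊥-elim (impossible β₁ β₂ eq β≺)
      where
      impossible : ∀ β₁ β₂ → β ≡ β₁ ++ t ∷ β₂ → StartsBelow m β → ⊥
      impossible []       β₂ refl (t<m ∷ _) = <-asym t<m m<t
      impossible (a ∷ β₁) β₂ refl (a<m ∷ _) = go (smalls m β₂) refl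
        where
        s = smalls m (a ∷ β₁)
        b≡ : b ≡ s ++ smalls m β₂
        b≡ = trans (sym β≡) (trans (filter-++ (_<? m) (a ∷ β₁) (t ∷ β₂)) (cong (s ++_) (smalls-> m<t)))
        s≢[] : s ≢ []
        s≢[] eq with () ← trans (sym (smalls-< a<m)) eq
        go : ∀ r → smalls m β₂ ≡ r → ⊥
        -- No small entry of `β` follows `t`, so `α₁ ++ β` ends in a large entry.
        go [] r≡ with x′ , e , eq , e≮m ← last-large t β₂ (trans (smalls-> m<t) r≡) =
          e≮m (ends (λ b≡[] → s≢[] (++-conicalˡ s _ (trans (sym b≡) b≡[]))) (α₁ ++ a ∷ β₁ ++ x′) e
            (trans (cong (λ y → α₁ ++ a ∷ β₁ ++ y) eq)
              (sym (trans (++-assoc α₁ (a ∷ β₁ ++ x′) (e ∷ []))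
                (cong (λ y → α₁ ++ a ∷ y) (++-assoc β₁ x′ (e ∷ [])))))))
        go (_ ∷ _) r≡ = un s (smalls m β₂) b≡ s≢[] (λ r≡[] → case (trans (sym r≡) r≡[]))
          (subst₂ GoodGap
            (trans (filter-++ (_<? m) α₁ (a ∷ β₁)) (cong (_++ s) α₁≡))
            (filter-++ (_<? m) β₂ z)
            (Allowed.gap (allowed (α₁ ++ a ∷ β₁) t (β₂ ++ z)
              (trans xs≡ (trans (cong (_++ z) (sym (++-assoc α₁ (a ∷ β₁) (t ∷ β₂))))
                (++-assoc (α₁ ++ a ∷ β₁) (t ∷ β₂) z))) m<t)))
          where
          case : ∀ {a : ℕ} {r : Word} → _≢_ {A = Word} (a ∷ r) []
          case ()

  -- Together `m`, the small entries and `z` make up the values up to `k`. Large entries decrease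
  -- from left to right, so the next one on the left has the next value.
  large-value : ∀ (bs : Vec Word g) b α l z k → xs ≡ α ++ l ∷ b ++ z → m < l → All (_< m) (flat bs) → All (_< m) b →
    m ∷ (flat bs ++ b) ++ z ↭ identity k → l ≡ suc k
  large-value bs b α l z k xs≡ m<l bs<m b<m p = ≤-antisym (≮⇒≥ not-greater) (≰⇒> not-less)
    where
    l∈xs = subst (l ∈_) (sym xs≡) (∈-++⁺ʳ α (here refl))
    m≤k : m ≤ k
    m≤k = proj₂ (∈-identity⁻ (∈-resp-↭ p (here refl)))
    not-less : ¬ l ≤ k
    not-less l≤k with ∈-resp-↭ (↭-sym p) (∈-identity⁺ (≤-<-trans z≤n m<l) l≤k)
    ... | here refl = <-irrefl refl m<l
    ... | there q with ∈-++⁻ (flat bs ++ b) q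
    ...   | inj₁ r = <-asym m<l (All.lookup (All.++⁺ bs<m b<m) r)
    ...   | inj₂ r with l∉ ∷ _ ← unique-++⁻ʳ α (subst Unique xs≡ xs-unique) = All.lookup l∉ (∈-++⁺ʳ b r) refl
    not-greater : ¬ suc k < l
    not-greater k<l with ∈-resp-↭ (↭-sym x↭)
      (∈-identity⁺ (s≤s z≤n) (≤-trans (<⇒≤ k<l) (proj₂ (∈-identity⁻ (∈-resp-↭ x↭ (there l∈xs))))))
    ... | here refl = <-irrefl refl m≤k
    ... | there q with ∈-++⁻ α (subst (suc k ∈_) xs≡ q)
    ...   | inj₂ (here refl) = <-irrefl refl k<l
    ...   | inj₂ (there r) with ∈-++⁻ b r
    ...     | inj₁ r₁ = <⇒≱ (<-trans (All.lookup b<m r₁) (s≤s m≤k)) ≤-refl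
    ...     | inj₂ r₂ = <⇒≱ (n<1+n k) (proj₂ (∈-identity⁻ (∈-resp-↭ p (there (∈-++⁺ʳ (flat bs ++ b) r₂)))))
    not-greater k<l | there q | inj₁ r with α₃ , α₄ , refl ← ∈-∃++ r =
      <⇒≱ k<l (Allowed.decreasing (allowed α₃ (suc k) (α₄ ++ l ∷ b ++ z)
        (trans xs≡ (++-assoc α₃ (suc k ∷ α₄) (l ∷ b ++ z))) (s≤s m≤k)) (∈-++⁺ʳ α₄ (here refl)))

  -- A code that ends with this stage and, if a large entry is still unread, a state for going on to
  -- a further stage; that state is reached by a `climb` at the leftmost large entry.
  Result : Word → Set
  Result α = (∃ λ c → decode c ≡ m ∷ xs) × (Any (m <_) α → Reached (m ∷ xs) (suc n))

  ends-before-large : ∀ α l z → xs ≡ (α ++ l ∷ []) ++ z → m < l → EndsBelow m α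
  ends-before-large α l z xs≡ m<l α′ e refl with <-cmp e m
  ... | tri< e<m _ _ = e<m
  ... | tri≈ _ refl _ = contradiction refl
    (All.lookup m∉xs (subst (e ∈_) (sym xs≡) (∈-++⁺ˡ (∈-++⁺ˡ (∈-++⁺ʳ α′ (here refl))))))
  ... | tri> _ _ m<e with l<m ∷ _ ← Allowed.next (allowed α′ e (l ∷ z)
    (trans xs≡ (trans (++-assoc (α′ ++ e ∷ []) (l ∷ []) z) (++-assoc α′ (e ∷ []) (l ∷ z)))) m<e) =
    contradiction m<l (<-asym l<m)

  -- Reads the code off from right to left, `z` being done and `α` unread. Large entries are never
  -- adjacent, so each gap holds at most one: this is a `bump` if there is one and a `fall` if not.
  scan : ∀ (bs : Vec Word g) α z k → xs ≡ α ++ z → smalls m α ≡ flat bs → Uncut (smalls m z) bs → EndOK m bs α →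
    m ∷ flat bs ++ z ↭ identity k → ReachF bs m z (suc k) → Result α
  scan [] [] z k refl _ _ _ _ reach = reach stop , λ ()
  scan [] (a ∷ α) z k xs≡ α≡ _ ends _ _ with x′ , e , eq , e≮m ← last-large a α α≡ = contradiction (ends x′ e eq) e≮m
  scan (b ∷ bs) α z k xs≡ α≡ un ends p reach with split-smalls α (flat bs) α≡
  ... | α₁ , β , refl , α₁≡ , β≡ , β≺ = go (initLast α₁) xs≡ α₁≡
    where
    β<m : All (_< m) β
    β<m = block-small bs α₁ β z xs≡ α₁≡ β≡ β≺ un ends
    β≡b : β ≡ b
    β≡b = trans (sym (filter-all (_<? m) β<m)) β≡
    b<m : All (_< m) b
    b<m = subst (All (_< m)) β≡b β<m
    bs<m : All (_< m) (flat bs)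
    bs<m = subst (All (_< m)) α₁≡ (All.all-filter (_<? m) α₁)
    un′ : Uncut (smalls m (b ++ z)) bs
    un′ = subst (λ w → Uncut w bs)
      (sym (trans (filter-++ (_<? m) b z) (cong (_++ smalls m z) (filter-all (_<? m) b<m)))) (proj₂ un)
    p′ : m ∷ flat bs ++ b ++ z ↭ identity k
    p′ = subst (λ w → m ∷ w ↭ identity k) (++-assoc (flat bs) b z) p
    reassoc : ∀ α₁ → xs ≡ (α₁ ++ β) ++ z → xs ≡ α₁ ++ b ++ z
    reassoc α₁ xs≡ = trans xs≡ (trans (++-assoc α₁ β z) (cong (λ y → α₁ ++ y ++ z) β≡b))
    drop-β : ∀ {α₁} → Any (m <_) (α₁ ++ β) → Any (m <_) α₁
    drop-β {α₁} q with Any.++⁻ α₁ q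
    ... | inj₁ r = r
    ... | inj₂ r = ⊥-elim (All.All¬⇒¬Any (All.map <-asym β<m) r)

    skip : ∀ α₁ → xs ≡ (α₁ ++ β) ++ z → smalls m α₁ ≡ flat bs → EndsBelow m α₁ → Result (α₁ ++ β)
    skip α₁ xs≡ α₁≡ ends₁ =
      let final , state = scan bs α₁ (b ++ z) k (reassoc α₁ xs≡) α₁≡ un′ (endOK bs ends₁) p′ (reach ∘ fall)
      in final , state ∘ drop-β {α₁}

    insert : ∀ α₁ l → xs ≡ ((α₁ ++ l ∷ []) ++ β) ++ z → smalls m (α₁ ++ l ∷ []) ≡ flat bs → m < l →
      Result ((α₁ ++ l ∷ []) ++ β)
    insert α₁ l xs≡ α₁≡ m<l = proj₁ rec , λ _ → state
      where
      xs≡′ : xs ≡ α₁ ++ l ∷ b ++ z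
      xs≡′ = trans (reassoc (α₁ ++ l ∷ []) xs≡) (++-assoc α₁ (l ∷ []) (b ++ z))
      α₁≡′ : smalls m α₁ ≡ flat bs
      α₁≡′ = trans (sym (trans (filter-++ (_<? m) α₁ (l ∷ []))
        (trans (cong (smalls m α₁ ++_) (smalls-> m<l)) (++-identityʳ _)))) α₁≡
      l≡ : l ≡ suc k
      l≡ = large-value bs b α₁ l z k xs≡′ m<l bs<m b<m p
      rec : Result α₁
      rec = scan bs α₁ (l ∷ b ++ z) (suc k) xs≡′ α₁≡′
        (subst (λ w → Uncut w bs) (sym (smalls-> m<l)) un′)
        (endOK bs (ends-before-large α₁ l (b ++ z) (trans xs≡′ (sym (++-assoc α₁ (l ∷ []) (b ++ z)))) m<l))
        (subst (λ l → m ∷ flat bs ++ l ∷ b ++ z ↭ identity (suc k)) (sym l≡) (identity-insert (m ∷ flat bs) p′))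
        (subst (λ l → ReachF bs m (l ∷ b ++ z) (suc (suc k))) (sym l≡) (reach ∘ bump))
      state : Reached (m ∷ xs) (suc n)
      state with any? (m <?_) α₁
      ... | yes q = proj₂ rec q
      -- Here `l` is the leftmost large entry, so the stage can be left by `climb`.
      ... | no ¬q = reached ((l ∷ b ++ z) ∷ (bs ▷ (m ∷ []))) flat≡
          (subst₂ (λ l N → ReachR ((l ∷ b ++ z) ∷ (bs ▷ (m ∷ []))) N) (sym l≡) (cong suc k≡n) (reach ∘ climb))
          (maximal-climb bs bs<m (proj₁ ∘ ∈-filter⁻ (_<? m)) m<l un′)
        where
        α₁<m : All (_< m) α₁
        α₁<m = All.tabulate λ {t} t∈ → ≤∧≢⇒< (≮⇒≥ (All.lookup (All.¬Any⇒All¬ α₁ ¬q) t∈))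
          (λ t≡m → All.lookup m∉xs (subst (t ∈_) (sym xs≡′) (∈-++⁺ˡ t∈)) (sym t≡m))
        flat≡ : flat ((l ∷ b ++ z) ∷ (bs ▷ (m ∷ []))) ≡ m ∷ xs
        flat≡ = trans (flat-climb bs m (l ∷ b ++ z)) (cong (m ∷_)
          (trans (cong (_++ l ∷ b ++ z) (trans (sym α₁≡′) (filter-all (_<? m) α₁<m))) (sym xs≡′)))
        k≡n : suc k ≡ n
        k≡n = trans (sym (length-permutation (identity-insert (m ∷ flat bs) p′)))
          (trans (cong length (trans (sym (flat-climb bs m (suc k ∷ b ++ z)))
            (trans (cong (λ l → flat ((l ∷ b ++ z) ∷ (bs ▷ (m ∷ [])))) (sym l≡)) flat≡)))
            (length-permutation x↭))

    go : InitLast α₁ → xs ≡ (α₁ ++ β) ++ z → smalls m α₁ ≡ flat bs → Result (α₁ ++ β)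
    go [] xs≡ α₁≡ = skip [] xs≡ α₁≡ λ { [] _ () ; (_ ∷ _) _ () }
    go (α ∷ʳ′ l) xs≡ α₁≡ with <-cmp l m
    ... | tri< l<m _ _ = skip (α ++ l ∷ []) xs≡ α₁≡ λ α′ e eq → subst (_< m) (proj₂ (∷ʳ-injective α α′ eq)) l<m
    ... | tri≈ _ refl _ = contradiction refl
      (All.lookup m∉xs (subst (l ∈_) (sym xs≡) (∈-++⁺ˡ (∈-++⁺ˡ (∈-++⁺ʳ α (here refl))))))
    ... | tri> _ _ m<l = insert α l xs≡ α₁≡ m<l

smalls-identity : ∀ {k n} → k ≤ n → smalls (suc k) (identity n) ≡ identity k
smalls-identity {zero}  {zero}  z≤n = refl
smalls-identity {k} {suc n} k≤ with m≤n⇒m<n∨m≡n k≤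
... | inj₂ refl = filter-all (_<? suc k) (All.tabulate λ t∈ → s≤s (proj₂ (∈-identity⁻ t∈)))
... | inj₁ (s≤s k≤n) = begin
  smalls (suc k) (identity (suc n))
    ≡⟨ cong (smalls (suc k)) (identity-suc n) ⟩
  smalls (suc k) (identity n ++ suc n ∷ [])
    ≡⟨ filter-++ (_<? suc k) (identity n) (suc n ∷ []) ⟩
  smalls (suc k) (identity n) ++ smalls (suc k) (suc n ∷ [])
    ≡⟨ cong₂ _++_ (smalls-identity k≤n) (filter-reject (_<? suc k) (≤⇒≯ (s≤s k≤n))) ⟩
  identity k ++ []
    ≡⟨ ++-identityʳ _ ⟩
  identity k ∎
  where open ≡-Reasoning

smalls-permutation : ∀ {k n xs} → suc k ∷ xs ↭ identity n → smalls (suc k) xs ↭ identity k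
smalls-permutation {k} {n} {xs} p = subst₂ _↭_ (filter-reject (_<? suc k) (<-irrefl refl))
  (smalls-identity (<⇒≤ (proj₂ (∈-identity⁻ (∈-resp-↭ p (here refl)))))) (filter-↭ (_<? suc k) p)

-- One stage: `turn` makes it the last one. Further stages follow a `climb`, supplied by `scan`, if
-- `xs` has a large entry, and an `up` otherwise.
reached-extend : ∀ {k n xs} → let μ = suc k in μ ∷ xs ↭ identity n → AllAllowed μ [] xs → Reached (smalls μ xs) μ →
  (∃ λ c → decode c ≡ μ ∷ xs) × Reached (μ ∷ xs) (suc n)
reached-extend {k} {n} {xs} x↭ allowed (reached bs@(b ∷ bs′) flat≡ reach max) = proj₁ result , state
  where
  μ = suc k
  m∷bs↭ : μ ∷ flat bs ↭ identity μ
  m∷bs↭ = identity-insert [] (subst (_↭ identity k) (sym flat≡) (smalls-permutation x↭))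
  ends : b ≢ [] → EndsBelow μ xs
  ends b≢ α l refl with <-cmp l μ
  ... | tri< l<m _ _ = l<m
  ... | tri≈ _ refl _ = contradiction refl (All.lookup (m∉xs x↭ allowed) (∈-++⁺ʳ α (here refl)))
  -- A large last entry would make the right end of the word of small entries a good gap, against
  -- maximality.
  ... | tri> _ _ m<l = contradiction
    (subst (λ w → GoodGap w []) (trans smalls≡ (sym flat≡)) (Allowed.gap (allowed α l [] refl m<l))) (proj₁ max b≢)
    where
    smalls≡ : smalls μ α ≡ smalls μ (α ++ l ∷ [])
    smalls≡ = sym (trans (filter-++ (_<? μ) α (l ∷ []))
      (trans (cong (smalls μ α ++_) (smalls-> m<l)) (++-identityʳ _)))
  result = scan x↭ allowed bs xs [] μ (sym (++-identityʳ xs)) (sym flat≡) (proj₂ max) ends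
    (subst (λ w → μ ∷ w ↭ identity μ) (sym (++-identityʳ (flat bs))) m∷bs↭) (reach ∘ turn)
  state : Reached (μ ∷ xs) (suc n)
  state with any? (μ <?_) xs
  ... | yes q = proj₂ result q
  ... | no ¬q = reached (bs ▷ (μ ∷ []))
      (trans (flat-▷ bs (μ ∷ [])) (cong (μ ∷_) (trans flat≡ (filter-all (_<? μ) xs<m))))
      (subst (λ N → ReachR (bs ▷ (μ ∷ [])) (suc N)) m≡n (reach ∘ up))
      (maximal-▷ bs (subst (All (_< μ)) (sym flat≡) (All.all-filter (_<? μ) xs)) max)
    where
    xs<m : All (_< μ) xs
    xs<m = All.tabulate λ {t} t∈ → ≤∧≢⇒< (≮⇒≥ (All.lookup (All.¬Any⇒All¬ xs ¬q) t∈))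
      (λ t≡m → All.lookup (m∉xs x↭ allowed) t∈ (sym t≡m))
    m≡n : μ ≡ n
    m≡n = trans (sym (length-permutation m∷bs↭))
      (trans (cong (λ w → suc (length w)) (trans flat≡ (filter-all (_<? μ) xs<m))) (length-permutation x↭))

head-allowed : ∀ {m n xs} → m ∷ xs ↭ identity n → Avoids231 (sort (m ∷ xs)) →
  Avoids231 (sort (smalls m xs)) × AllAllowed m [] xs
head-allowed {m} {n} {xs} x↭ av with m∉ ∷ uq ← permutation-unique x↭ =
  necessary [] xs [] [] [] (All.map (λ m≢ → m≢ ∘ sym) m∉) uq (λ {_} → av)

-- Induction on a bound for the length: removing the first entry and all larger ones leaves a
-- shorter sortable permutation.
permutation-reached : ∀ fuel {n} x → length x ≤ fuel → x ↭ identity n → Avoids231 (sort x) → Reached x (suc n)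
permutation-extend : ∀ fuel {n m} xs → length xs ≤ fuel → m ∷ xs ↭ identity n → Avoids231 (sort (m ∷ xs)) →
  (∃ λ c → decode c ≡ m ∷ xs) × Reached (m ∷ xs) (suc n)

permutation-reached fuel [] _ x↭ _ = subst (λ k → Reached [] (suc k)) (length-permutation x↭)
  (reached ([] ∷ []) refl (λ c → c , refl) ((λ []≢ → contradiction refl []≢) , noSplit , tt))
  where
  noSplit : ∀ b₁ b₂ → [] ≡ b₁ ++ b₂ → b₁ ≢ [] → b₂ ≢ [] → ¬ GoodGap b₁ (b₂ ++ [])
  noSplit b₁ b₂ eq b₁≢ _ _ = b₁≢ (++-conicalˡ b₁ b₂ (sym eq))
permutation-reached (suc fuel) (m ∷ xs) (s≤s len) x↭ av = proj₂ (permutation-extend fuel xs len x↭ (λ {_} → av))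

permutation-extend fuel {m = zero} xs _ x↭ with () ← proj₁ (∈-identity⁻ (∈-resp-↭ x↭ (here refl)))
permutation-extend fuel {m = suc k} xs len x↭ av =
  let av′ , allowed = head-allowed x↭ (λ {_} → av)
  in reached-extend x↭ allowed
    (permutation-reached fuel (smalls (suc k) xs) (≤-trans (length-filter (_<? suc k) xs) len)
      (smalls-permutation x↭) (λ {_} → av′))

decode-surjective : ∀ {n x} → x ↭ identity (suc n) → Avoids231 (sort x) → ∃ λ c → decode c ≡ x
decode-surjective {x = []} x↭ with () ← length-permutation x↭
decode-surjective {x = m ∷ xs} x↭ av = proj₁ (permutation-extend (length xs) xs ≤-refl x↭ (λ {_} → av))

-- Counting sortable permutations

sort-card : ∀ n → HasCardinality (Sort (suc n) (1 ∷ 3 ∷ 2 ∷ []) (3 ∷ 2 ∷ 1 ∷ [])) (length (allRise n 1))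
sort-card n = card-image decode (allRise n 1) (allRise-unique n 1) decode-injective sound complete
  where
  Sortable = Sort (suc n) (1 ∷ 3 ∷ 2 ∷ []) (3 ∷ 2 ∷ 1 ∷ [])
  sorts⇔ : ∀ {x} → x ↭ identity (suc n) → west (sort x) ≡ identity (suc n) ⇔ Avoids231 (sort x)
  sorts⇔ x↭ = west-sorts⇔ (↭-trans (process-↭ patterns [] _) x↭)
  sound : ∀ {c} → c ∈ allRise n 1 → Sortable (decode c)
  sound {c} c∈ = x↭ , Equivalence.from (sorts⇔ x↭) (decode-avoids231 c)
    where
    x↭ : decode c ↭ identity (suc n)
    x↭ = subst (λ s → decode c ↭ identity (suc s)) (sizeR-all n c∈) (decodeR-↭ ([] ∷ []) 0 c ↭-refl)
  complete : ∀ {x} → Sortable x → ∃ λ c → c ∈ allRise n 1 × decode c ≡ x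
  complete (x↭ , eq) with c , refl ← decode-surjective x↭ (Equivalence.to (sorts⇔ x↭) eq) =
    c , subst (λ s → c ∈ allRise s 1) size (∈-allRise c) , refl
    where
    size : sizeR c ≡ n
    size = suc-injective (trans (sym (length-permutation (decodeR-↭ ([] ∷ []) 0 c ↭-refl))) (length-permutation x↭))

theorem1p1 : ∀ (n : ℕ) → n ≥ 1 →
    ∃ λ (k : ℕ) →
    HasCardinality (Sort n (1 ∷ 3 ∷ 2 ∷ []) (3 ∷ 2 ∷ 1 ∷ [])) k
    × HasCardinality (DyckAvoidingFactor n (d ∷ u ∷ d ∷ u ∷ [])) k
theorem1p1 (suc n) _ = length (allRise n 1) , sort-card n , dyck-card n
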